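{- No single-threshold constant-approximation is possible on the $\overline{\mathcal{G}}$ class: there is no constant $c>0$ such that for every horizon $H\in\overline{\mathcal{G}}$ and every value distribution $\mathcal{D}$ there exists a threshold $\pi$ with $\mathbb{E}X_{\tau_\pi}\ge c\,\mathbb{E}M_H$.
   Context: IID prophet inequality with random horizon: $X$ is a nonnegative integrable random variable with distribution $\mathcal{D}$, $X_1,X_2,\dots$ i.i.d. copies. A horizon is a random variable $H$ supported on a subset of $\mathbb{N}=\{1,2,\dots\}$ with $\mathbb{E}H<\infty$, independent of the $X_i$. A stopping rule $\tau$ is adapted to $\mathcal{F}_i=\sigma(\mathbb{1}_{\{H=0\}},X_1,\dots,\mathbb{1}_{\{H=i-1\}},X_i)$ (the gambler must decide at step $i$ before learning whether $H=i$), the reward is $Y_\tau$ with $Y_i=X_i\mathbb{1}_{\{H\ge i\}}$, $Y_\infty=0$, and $\mathbb{E}X_\tau:=\mathbb{E}Y_\tau$. The prophet gets $\mathbb{E}M_H$, $M_H=\max_{i\le H}X_i$. A single-threshold algorithm with threshold $\pi$ (chosen knowing $\mathcal{D}$ and the law of $H$) is $\tau_\pi=\inf\{i: Y_i\ge\pi\}$. The $\overline{\mathcal{G}}$ class: $H\in\overline{\mathcal{G}}$ iff $\mathbb{E}[t^G]\le\mathbb{E}[t^H]$ for all $t\in(0,1)$, where $G$ is geometric on $\mathbb{N}$ with mean $\mu=\mathbb{E}H$, $\mathbb{P}(G=h)=\frac1\mu(1-\frac1\mu)^{h-1}$. -}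

module Defs where

open import Level using (0ℓ; suc; Lift)
open import Algebra.Bundles using (CommutativeRing; Semiring)
open import Data.Nat.Base as ℕ using (ℕ)
open import Data.Fin.Base as Fin using (Fin; toℕ)
open import Data.Maybe.Base as Maybe using (Maybe; just; nothing; maybe′)
open import Data.Product.Base using (_×_; Σ-syntax; ∃-syntax)
open import Data.Vec.Base as Vec using (Vec; []; _∷_; lookup)
open import Data.Bool.Base using (if_then_else_)
open import Function.Base using (_∘_)
open import Relation.Binary.Bundles using (DecTotalOrder)
open import Relation.Binary.Core using (Rel)
open import Relation.Binary.Structures using (IsDecTotalOrder)
open import Relation.Binary.PropositionalEquality.Core using (_≢_)
open import Relation.Nullary.Decidable.Core using (does)
open import Relation.Nullary.Negation.Core using (¬_)
open import Relation.Unary using (Pred; _∈_; _≐_; _⊥_; U; ∁; ⋃; Satisfiable)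
import Algebra.Construct.NaturalChoice.Max as Max
import Algebra.Definitions.RawSemiring as RawSemiringDefs
import Relation.Binary.Properties.DecTotalOrder as DecTotalOrderProperties

module _ {A : Set} (_≤_ : Rel A 0ℓ) {ℓ} (S : Pred A ℓ) where

  UpperBound : Pred A ℓ
  UpperBound b = ∀ x → x ∈ S → x ≤ b

  BoundedAbove : Set ℓ
  BoundedAbove = ∃[ b ] UpperBound b

  IsLub : Pred A ℓ
  IsLub s = UpperBound s × (∀ b → UpperBound b → s ≤ b)

-- Dedekind-complete ordered fields; classically ℝ is the only one up to
-- isomorphism.  `_⁻¹` and `sup` are total and unconstrained where they are
-- meaningless (at 0, and on empty or unbounded sets).
record CompleteOrderedField : Set (suc (suc 0ℓ)) where
  infix  8 _⁻¹
  infix  4 _≤_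
  field
    commutativeRing : CommutativeRing 0ℓ 0ℓ

  open CommutativeRing commutativeRing public

  field
    _≤_             : Rel Carrier 0ℓ
    isDecTotalOrder : IsDecTotalOrder _≈_ _≤_
    +-monoʳ-≤       : ∀ x {y z} → y ≤ z → x + y ≤ x + z
    *-nonNegative   : ∀ {x y} → 0# ≤ x → 0# ≤ y → 0# ≤ x * y
    0≉1             : ¬ (0# ≈ 1#)
    _⁻¹             : Carrier → Carrier
    ⁻¹-inverseʳ     : ∀ x → ¬ (x ≈ 0#) → x * x ⁻¹ ≈ 1#
    sup             : Pred Carrier (suc 0ℓ) → Carrier
    sup-isLub       : ∀ S → Satisfiable S → BoundedAbove _≤_ S →
                      IsLub _≤_ S (sup S)

  decTotalOrder : DecTotalOrder 0ℓ 0ℓ 0ℓ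
  decTotalOrder = record { isDecTotalOrder = isDecTotalOrder }

  open DecTotalOrder decTotalOrder public
    using (_≤?_; totalOrder)
  open DecTotalOrderProperties decTotalOrder public
    using (_<_)
  open Max totalOrder public
    using (_⊔_)
  open RawSemiringDefs (Semiring.rawSemiring semiring) public
    using (sum; _^_) renaming (_×_ to _·_)

module ProphetInequality (R : CompleteOrderedField) where

  open CompleteOrderedField R renaming (Carrier to ℝ)

  partialSum : (ℕ → ℝ) → ℕ → ℝ
  partialSum f n = sum {n} (f ∘ toℕ)

  PartialSums : (ℕ → ℝ) → Pred ℝ (suc 0ℓ)
  PartialSums f s = Lift (suc 0ℓ) (∃[ n ] s ≈ partialSum f n)

  -- Only used for nonnegative terms.
  ∑∞ : (ℕ → ℝ) → ℝ
  ∑∞ f = sup (PartialSums f)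

  record ProbabilitySpace : Set (suc (suc 0ℓ)) where
    field
      Ω            : Set
      Measurable   : Pred (Pred Ω 0ℓ) (suc 0ℓ)
      measurable-≐ : ∀ {A B} → A ≐ B → Measurable A → Measurable B
      measurable-U : Measurable U
      measurable-∁ : ∀ {A} → Measurable A → Measurable (∁ A)
      measurable-⋃ : ∀ {A : ℕ → Pred Ω 0ℓ} → (∀ i → Measurable (A i)) →
                     Measurable (⋃ ℕ A)
      ℙ            : Pred Ω 0ℓ → ℝ
      ℙ-cong       : ∀ {A B} → Measurable A → A ≐ B → ℙ A ≈ ℙ B
      ℙ-nonNeg     : ∀ {A} → Measurable A → 0# ≤ ℙ A
      ℙ-U          : ℙ U ≈ 1#
      ℙ-σ-additive : ∀ {A : ℕ → Pred Ω 0ℓ} → (∀ i → Measurable (A i)) →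
                     (∀ {i j} → i ≢ j → A i ⊥ A j) →
                     IsLub _≤_ (PartialSums (ℙ ∘ A)) (ℙ (⋃ ℕ A))

    -- Integrals of the simple functions Σ aᵢ 1_{Aᵢ} ≤ f with aᵢ ≥ 0 and
    -- the Aᵢ measurable and pairwise disjoint.
    SimpleIntegralsBelow : (Ω → ℝ) → Pred ℝ (suc 0ℓ)
    SimpleIntegralsBelow f s =
      Σ[ n ∈ ℕ ] Σ[ a ∈ (Fin n → ℝ) ] Σ[ A ∈ (Fin n → Pred Ω 0ℓ) ]
        (∀ i → Measurable (A i)) ×
        (∀ {i j} → i ≢ j → A i ⊥ A j) ×
        (∀ i → 0# ≤ a i) ×
        (∀ i ω → ω ∈ A i → a i ≤ f ω) ×
        s ≈ sum (λ i → a i * ℙ (A i))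

    -- The Lebesgue integral, for nonnegative measurable f.
    ∫ : (Ω → ℝ) → ℝ
    ∫ f = sup (SimpleIntegralsBelow f)

    Integrable : (Ω → ℝ) → Set (suc 0ℓ)
    Integrable f = BoundedAbove _≤_ (SimpleIntegralsBelow f)

    -- The expectation of F (ω₁, …, ωₙ) under the n-fold product measure.
    ∫^ : ∀ n → (Vec Ω n → ℝ) → ℝ
    ∫^ ℕ.zero    F = F []
    ∫^ (ℕ.suc n) F = ∫ (λ ω → ∫^ n (λ ωs → F (ω ∷ ωs)))

  -- The law of X is the value distribution 𝒟.
  record Value : Set (suc (suc 0ℓ)) where
    field
      space : ProbabilitySpace

    open ProbabilitySpace space public

    field
      X            : Ω → ℝ
      X-measurable : ∀ a → Measurable (λ ω → a ≤ X ω)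
      X-nonNeg     : ∀ ω → 0# ≤ X ω
      X-integrable : Integrable X

  -- 𝔼[g(H)] for g ≥ 0, where p is the mass function of H.
  𝔼⟨_⟩ : (ℕ → ℝ) → (ℕ → ℝ) → ℝ
  𝔼⟨ p ⟩ g = ∑∞ (λ h → p h * g h)

  pgf : (ℕ → ℝ) → ℝ → ℝ
  pgf p t = 𝔼⟨ p ⟩ (t ^_)

  -- An integrable horizon on {1, 2, …}, given by its law.
  record Horizon : Set (suc 0ℓ) where
    field
      pmf         : ℕ → ℝ
      pmf-nonNeg  : ∀ h → 0# ≤ pmf h
      pmf-0       : pmf 0 ≈ 0#
      pmf-total   : IsLub _≤_ (PartialSums pmf) 1#
      mean-finite : BoundedAbove _≤_
                      (PartialSums (λ h → pmf h * (h · 1#)))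

    mean : ℝ
    mean = 𝔼⟨ pmf ⟩ (_· 1#)

  geometricPmf : ℝ → ℕ → ℝ
  geometricPmf μ ℕ.zero    = 0#
  geometricPmf μ (ℕ.suc k) = μ ⁻¹ * (1# - μ ⁻¹) ^ k

  Ḡ : Pred Horizon 0ℓ
  Ḡ H = ∀ t → 0# < t → t < 1# → pgf (geometricPmf mean) t ≤ pgf pmf t
    where open Horizon H

  -- First i with Yᵢ ≥ π, given the values X₁, …, X_h up to the realised
  -- horizon h ≥ 1.  Searching these suffices: Yᵢ = 0 for i > h, so if π > 0
  -- no later i qualifies, and if π ≤ 0 then already i = 1 does.
  τ : ℝ → ∀ {h} → Vec ℝ h → Maybe (Fin h)
  τ π []       = nothing
  τ π (x ∷ xs) = if does (π ≤? x) then just Fin.zero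
                                  else Maybe.map Fin.suc (τ π xs)

  Y-τ : ℝ → ∀ {h} → Vec ℝ h → ℝ
  Y-τ π xs = maybe′ (lookup xs) 0# (τ π xs)

  -- The starting value 0 is harmless because values are nonnegative.
  M : ∀ {h} → Vec ℝ h → ℝ
  M = Vec.foldr′ _⊔_ 0#

  -- Expectation of F (X₁, …, X_H), with H independent of the i.i.d. copies
  -- X₁, X₂, … of X.
  𝔼[_,_] : Horizon → Value → (∀ {h} → Vec ℝ h → ℝ) → ℝ
  𝔼[ H , D ] F = 𝔼⟨ pmf ⟩ (λ h → ∫^ h (λ ωs → F (Vec.map X ωs)))
    where
    open Horizon H
    open Value D

{-# OPTIONS --safe #-}

-- Fix n levels i < n and let the values be vᵢ = 16ⁱ with probability about
-- 32⁻ⁱ and the horizons hᵢ = 32ⁱ with probability about 16⁻ⁱ.  Given H = hᵢ, the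
-- prophet sees vᵢ with constant probability, so every level contributes a
-- constant to 𝔼 M and 𝔼 M ≥ n/6.  A threshold selecting the levels from j on
-- has 𝔼[X; X ≥ π] ≤ 3·2⁻ʲ, so it gains at most hᵢ · 3·2⁻ʲ from short horizons
-- and at most 3·2⁻ʲ / ℙ(X ≥ π) from long ones; weighted, level i contributes
-- O(2^-|i-j|), a total of at most 18.
--
-- For H ∈ Ḡ it is enough that ℙ(H = 1) ≥ 7/8 and H ∉ {2}: writing J = H - 1,
-- δ = 1 - t and F = 𝔼[1 - tᴶ], domination of the geometric law amounts to
-- F (1 + 𝔼J δ) ≤ 𝔼J δ, which follows from 1 - tᵏ ≤ kδ / (1 + kδ/4) for k ≥ 2.

module Submission where

open import Defs
open import Axiom.ExcludedMiddle using (ExcludedMiddle)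
open import Algebra.Solver.Ring.AlmostCommutativeRing
  using (fromCommutativeRing; _-Raw-AlmostCommutative⟶_)
open import Data.Empty using (⊥; ⊥-elim)
open import Data.Fin.Base as Fin using (Fin; toℕ)
import Data.Fin.Properties as Fin
open import Data.Integer.Base as ℤ using (ℤ; +_; -[1+_])
import Data.Integer.Properties as ℤ
open import Data.Maybe.Base using (Maybe; just; nothing)
open import Data.Nat.Base as ℕ using (ℕ; zero; suc; ∣_-_∣)
import Data.Nat.Properties as ℕ
open import Data.Product.Base using (_×_; _,_; proj₁; proj₂; ∃-syntax)
open import Data.Sign.Base as Sign using (Sign)
open import Data.Sum.Base using (_⊎_; inj₁; inj₂)
open import Data.Unit.Base using (⊤; tt)
open import Data.Vec.Base as Vec using (Vec; []; _∷_)
open import Function.Base using (_∘_)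
open import Level using (0ℓ; Lift; lift)
open import Relation.Binary.Bundles using (DecTotalOrder)
open import Relation.Binary.PropositionalEquality.Core as ≡ using (_≡_; _≢_)
open import Relation.Nullary.Decidable.Core using (Dec; yes; no)
open import Relation.Nullary.Negation.Core using (¬_)
open import Relation.Unary using (Pred; _∈_; ⋃)
import Algebra.Construct.NaturalChoice.Max
import Algebra.Properties.AbelianGroup
import Algebra.Properties.CommutativeSemiring.Exp
import Algebra.Properties.Ring
import Algebra.Properties.Semiring.Mult
import Algebra.Properties.Semiring.Mult.TCOptimised
import Algebra.Properties.Semiring.Sum
import Algebra.Solver.Ring
import Relation.Binary.Reasoning.PartialOrder
import Relation.Binary.Reasoning.Setoid

-- The scales 16 and 32 come from a balance. The products `ℙ(X = vᵢ) hᵢ` and `ℙ(H = hᵢ) vᵢ` are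
-- about 1 at every level, which makes every level equally valuable to the prophet. On the other
-- hand `ℙ(X = vᵢ) vᵢ` is about 2^-i and `ℙ(H = hᵢ) hᵢ` about 2^i. These opposite drifts confine the
-- gain of a threshold to the levels near the lowest one that it selects. Level 0 absorbs the
-- leftover mass, at the cost of a factor two.
--
-- The obstacle is membership in Ḡ. With x = kδ the required inequality says F ≤ N / (1 + N) for the
-- averages F of 1 - t^k and N of x, but 1 - t^k ≤ x / (1 + x) fails for every single k when t is
-- near 1. Mixing repairs this: if the levels above 0 have total weight W, Jensen's inequality for x
-- / (1 + x/4) gives F ≤ N / (1 + N/(4W)), so W ≤ 1/4 would do. The elementary substitute for Jensen
-- used here loses a factor two, whence W ≤ 1/8 and the mass 7/8 at H = 1.

-- Ring normalisation over the reals with integer constants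

module IntegerCoefficients (R : CompleteOrderedField) where

  open CompleteOrderedField R renaming (Carrier to ℝ)
  open Algebra.Properties.Ring ring
    using (-‿distribˡ-*; -‿distribʳ-*; -0#≈0#; -‿involutive)
  open Algebra.Properties.AbelianGroup +-abelianGroup using (⁻¹-∙-comm)
  open Algebra.Properties.Semiring.Mult.TCOptimised semiring public
    using (×-homo-+; ×1-homo-*; 1+×; ×ᵤ≈×) renaming (_×_ to _·′_)
  open Relation.Binary.Reasoning.Setoid setoid

  -- With the optimised multiple, `ι (+ 1)` is `1#` itself and `ι (+ 2)` is `1# + 1#`, so the
  -- constants of the solver agree definitionally with the terms in the goals.
  ι : ℤ → ℝ
  ι (+ n)    = n ·′ 1#
  ι -[1+ n ] = - (suc n ·′ 1#)

  private
    ι-⊖-suc : ∀ a x y → (a + x) + - (a + y) ≈ x + - y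
    ι-⊖-suc a x y = begin
      (a + x) + - (a + y)     ≈⟨ +-cong (+-comm x a) (⁻¹-∙-comm a y) ⟨
      (x + a) + (- a + - y)   ≈⟨ +-assoc x a _ ⟩
      x + (a + (- a + - y))   ≈⟨ +-congˡ (+-assoc a _ _) ⟨
      x + ((a + - a) + - y)   ≈⟨ +-congˡ (+-congʳ (-‿inverseʳ a)) ⟩
      x + (0# + - y)          ≈⟨ +-congˡ (+-identityˡ _) ⟩
      x + - y                 ∎

  ι-⊖ : ∀ m n → ι (m ℤ.⊖ n) ≈ m ·′ 1# + - (n ·′ 1#)
  ι-⊖ zero    zero    = sym (-‿inverseʳ 0#)
  ι-⊖ zero    (suc n) = sym (+-identityˡ _)
  ι-⊖ (suc m) zero    = sym (trans (+-congˡ -0#≈0#) (+-identityʳ _))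
  ι-⊖ (suc m) (suc n) = begin
    ι (suc m ℤ.⊖ suc n)                    ≡⟨ ≡.cong ι (ℤ.[1+m]⊖[1+n]≡m⊖n m n) ⟩
    ι (m ℤ.⊖ n)                            ≈⟨ ι-⊖ m n ⟩
    m ·′ 1# + - (n ·′ 1#)                  ≈⟨ ι-⊖-suc 1# _ _ ⟨
    (1# + m ·′ 1#) + - (1# + n ·′ 1#)      ≈⟨ +-cong (1+× m 1#) (-‿cong (1+× n 1#)) ⟨
    suc m ·′ 1# + - (suc n ·′ 1#)          ∎

  ι-+ : ∀ i j → ι (i ℤ.+ j) ≈ ι i + ι j
  ι-+ (+ m)    (+ n)    = ×-homo-+ 1# m n
  ι-+ (+ m)    -[1+ n ] = ι-⊖ m (suc n)
  ι-+ -[1+ m ] (+ n)    = trans (ι-⊖ n (suc m)) (+-comm _ _)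
  ι-+ -[1+ m ] -[1+ n ] = begin
    - (suc (suc (m ℕ.+ n)) ·′ 1#)         ≡⟨ ≡.cong (λ k → - (k ·′ 1#)) (ℕ.+-suc (suc m) n) ⟨
    - ((suc m ℕ.+ suc n) ·′ 1#)           ≈⟨ -‿cong (×-homo-+ 1# (suc m) (suc n)) ⟩
    - (suc m ·′ 1# + suc n ·′ 1#)         ≈⟨ ⁻¹-∙-comm _ _ ⟨
    - (suc m ·′ 1#) + - (suc n ·′ 1#)     ∎

  ι-neg : ∀ i → ι (ℤ.- i) ≈ - ι i
  ι-neg (+ zero)  = sym -0#≈0#
  ι-neg (+ suc n) = refl
  ι-neg -[1+ n ]  = sym (-‿involutive _)

  ι-* : ∀ i j → ι (i ℤ.* j) ≈ ι i * ι j
  ι-* (+ m)    (+ n)    = trans (reflexive (≡.cong ι (ℤ.+◃n≡+n (m ℕ.* n)))) (×1-homo-* m n)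
  ι-* (+ m)    -[1+ n ] = begin
    ι (Sign.- ℤ.◃ m ℕ.* suc n)      ≡⟨ ≡.cong ι (ℤ.-◃n≡-n (m ℕ.* suc n)) ⟩
    ι (ℤ.- (+ (m ℕ.* suc n)))       ≈⟨ ι-neg (+ (m ℕ.* suc n)) ⟩
    - ((m ℕ.* suc n) ·′ 1#)         ≈⟨ -‿cong (×1-homo-* m (suc n)) ⟩
    - ((m ·′ 1#) * (suc n ·′ 1#))   ≈⟨ -‿distribʳ-* _ _ ⟩
    (m ·′ 1#) * - (suc n ·′ 1#)     ∎
  ι-* -[1+ m ] (+ n)    = begin
    ι (Sign.- ℤ.◃ suc m ℕ.* n)      ≡⟨ ≡.cong ι (ℤ.-◃n≡-n (suc m ℕ.* n)) ⟩
    ι (ℤ.- (+ (suc m ℕ.* n)))       ≈⟨ ι-neg (+ (suc m ℕ.* n)) ⟩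
    - ((suc m ℕ.* n) ·′ 1#)         ≈⟨ -‿cong (×1-homo-* (suc m) n) ⟩
    - ((suc m ·′ 1#) * (n ·′ 1#))   ≈⟨ -‿distribˡ-* _ _ ⟩
    - (suc m ·′ 1#) * (n ·′ 1#)     ∎
  ι-* -[1+ m ] -[1+ n ] = begin
    (suc m ℕ.* suc n) ·′ 1#                 ≈⟨ ×1-homo-* (suc m) (suc n) ⟩
    (suc m ·′ 1#) * (suc n ·′ 1#)           ≈⟨ -‿involutive _ ⟨
    - - ((suc m ·′ 1#) * (suc n ·′ 1#))     ≈⟨ -‿cong (-‿distribʳ-* _ _) ⟩
    - ((suc m ·′ 1#) * - (suc n ·′ 1#))     ≈⟨ -‿distribˡ-* _ _ ⟩
    - (suc m ·′ 1#) * - (suc n ·′ 1#)       ∎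

  ι-homomorphism : ℤ.+-*-rawRing -Raw-AlmostCommutative⟶ fromCommutativeRing commutativeRing
  ι-homomorphism = record
    { ⟦_⟧    = ι
    ; +-homo = ι-+
    ; *-homo = ι-*
    ; -‿homo = ι-neg
    ; 0-homo = refl
    ; 1-homo = refl
    }

  ι-≟ : ∀ i j → Maybe (ι i ≈ ι j)
  ι-≟ i j with i ℤ.≟ j
  ... | yes i≡j = just (reflexive (≡.cong ι i≡j))
  ... | no  _   = nothing

  open Algebra.Solver.Ring ℤ.+-*-rawRing (fromCommutativeRing commutativeRing)
    ι-homomorphism ι-≟ public
    using (solve; _:=_; _:+_; _:*_; _:-_; :-_; con)

-- Ordered-field arithmetic and finite sums

module OrderedFieldProperties (R : CompleteOrderedField) where

  open CompleteOrderedField R renaming (Carrier to ℝ)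
  open IntegerCoefficients R public
    using (solve; _:=_; _:+_; _:*_; _:-_; :-_; con; _·′_; ×ᵤ≈×)
  open DecTotalOrder decTotalOrder public using (poset; ≤-respˡ-≈; ≤-respʳ-≈)
    renaming ( refl to ≤-refl; trans to ≤-trans; reflexive to ≤-reflexive
             ; antisym to ≤-antisym; total to ≤-total)
  open Algebra.Properties.CommutativeSemiring.Exp commutativeSemiring public
    using (^-congˡ; ^-homo-*; ^-distrib-*)
  open Algebra.Properties.Semiring.Mult semiring public
    using () renaming (×1-homo-* to ·1-homo-*)
  open Algebra.Properties.Semiring.Sum semiring public
    using (sum-cong-≋; ∑-distrib-+; ∑-comm; *-distribˡ-sum; *-distribʳ-sum; sum-replicate-zero)
  open Relation.Binary.Reasoning.PartialOrder poset

  0≤-diff : ∀ {x y} → x ≤ y → 0# ≤ y - x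
  0≤-diff {x} {y} x≤y = begin
    0#      ≈⟨ -‿inverseˡ x ⟨
    - x + x ≤⟨ +-monoʳ-≤ (- x) x≤y ⟩
    - x + y ≈⟨ +-comm _ _ ⟩
    y - x   ∎

  -- The standard certificate for the polynomial inequalities of the development: the slack is
  -- displayed as a combination of nonnegative products, and the ring solver checks the identity.
  ≤-from-slack : ∀ {x y d} → 0# ≤ d → y ≈ x + d → x ≤ y
  ≤-from-slack {x} {y} {d} 0≤d y≈x+d = begin
    x      ≈⟨ +-identityʳ x ⟨
    x + 0# ≤⟨ +-monoʳ-≤ x 0≤d ⟩
    x + d  ≈⟨ y≈x+d ⟨
    y      ∎

  +-mono-≤ : ∀ {x y u v} → x ≤ y → u ≤ v → x + u ≤ y + v
  +-mono-≤ {x} {y} {u} {v} x≤y u≤v = begin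
    x + u ≤⟨ +-monoʳ-≤ x u≤v ⟩
    x + v ≈⟨ +-comm x v ⟩
    v + x ≤⟨ +-monoʳ-≤ v x≤y ⟩
    v + y ≈⟨ +-comm v y ⟩
    y + v ∎

  +-nonNegative : ∀ {x y} → 0# ≤ x → 0# ≤ y → 0# ≤ x + y
  +-nonNegative {x} {y} 0≤x 0≤y = begin
    0#      ≈⟨ +-identityʳ 0# ⟨
    0# + 0# ≤⟨ +-mono-≤ 0≤x 0≤y ⟩
    x + y   ∎

  *-monoˡ-≤ : ∀ {x y z} → 0# ≤ z → x ≤ y → z * x ≤ z * y
  *-monoˡ-≤ {x} {y} {z} 0≤z x≤y = ≤-from-slack (*-nonNegative 0≤z (0≤-diff x≤y))
    (solve 3 (λ x y z → z :* y := z :* x :+ z :* (y :- x)) refl x y z)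

  *-monoʳ-≤ : ∀ {x y z} → 0# ≤ z → x ≤ y → x * z ≤ y * z
  *-monoʳ-≤ {x} {y} {z} 0≤z x≤y = begin
    x * z ≈⟨ *-comm x z ⟩
    z * x ≤⟨ *-monoˡ-≤ 0≤z x≤y ⟩
    z * y ≈⟨ *-comm z y ⟩
    y * z ∎

  *-mono-≤ : ∀ {x y u v} → 0# ≤ u → 0# ≤ y → x ≤ y → u ≤ v → x * u ≤ y * v
  *-mono-≤ 0≤u 0≤y x≤y u≤v = ≤-trans (*-monoʳ-≤ 0≤u x≤y) (*-monoˡ-≤ 0≤y u≤v)

  0≤1 : 0# ≤ 1#
  0≤1 with ≤-total 0# 1#
  ... | inj₁ 0≤1 = 0≤1
  ... | inj₂ 1≤0 = begin
    0#                      ≤⟨ *-nonNegative (0≤-diff 1≤0) (0≤-diff 1≤0) ⟩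
    (0# - 1#) * (0# - 1#)   ≈⟨ solve 0 ((con (+ 0) :- con (+ 1)) :* (con (+ 0) :- con (+ 1)) := con (+ 1)) refl ⟩
    1#                      ∎

  1≰0 : ¬ (1# ≤ 0#)
  1≰0 1≤0 = 0≉1 (≤-antisym 0≤1 1≤0)

  ·-nonNegative : ∀ n {x} → 0# ≤ x → 0# ≤ n · x
  ·-nonNegative zero    0≤x = ≤-refl
  ·-nonNegative (suc n) 0≤x = +-nonNegative 0≤x (·-nonNegative n 0≤x)

  ·′1-nonNegative : ∀ n → 0# ≤ n ·′ 1#
  ·′1-nonNegative n = ≤-respʳ-≈ (×ᵤ≈× n 1#) (·-nonNegative n 0≤1)

  ^-nonNegative : ∀ {x} → 0# ≤ x → ∀ n → 0# ≤ x ^ n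
  ^-nonNegative 0≤x zero    = 0≤1
  ^-nonNegative 0≤x (suc n) = *-nonNegative 0≤x (^-nonNegative 0≤x n)

  ^-≤1 : ∀ {x} → 0# ≤ x → x ≤ 1# → ∀ n → x ^ n ≤ 1#
  ^-≤1 0≤x x≤1 zero    = ≤-refl
  ^-≤1 {x} 0≤x x≤1 (suc n) = begin
    x * x ^ n ≤⟨ *-mono-≤ (^-nonNegative 0≤x n) 0≤1 x≤1 (^-≤1 0≤x x≤1 n) ⟩
    1# * 1#   ≈⟨ *-identityˡ 1# ⟩
    1#        ∎

  1^n≈1 : ∀ n → 1# ^ n ≈ 1#
  1^n≈1 zero    = refl
  1^n≈1 (suc n) = trans (*-identityˡ _) (1^n≈1 n)

  ^-mono-≤ : ∀ {x y} → 0# ≤ x → x ≤ y → ∀ n → x ^ n ≤ y ^ n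
  ^-mono-≤ 0≤x x≤y zero    = ≤-refl
  ^-mono-≤ 0≤x x≤y (suc n) =
    *-mono-≤ (^-nonNegative 0≤x n) (≤-trans 0≤x x≤y) x≤y (^-mono-≤ 0≤x x≤y n)

  *-cancelˡ-≤ : ∀ {x y z} → 0# ≤ z → ¬ (z ≈ 0#) → z * x ≤ z * y → x ≤ y
  *-cancelˡ-≤ {x} {y} {z} 0≤z z≉0 zx≤zy with ≤-total x y
  ... | inj₁ x≤y = x≤y
  ... | inj₂ y≤x = ≤-reflexive (begin-equality
    x                ≈⟨ inv x ⟩
    z ⁻¹ * (z * x)   ≈⟨ *-congˡ (≤-antisym zx≤zy (*-monoˡ-≤ 0≤z y≤x)) ⟩
    z ⁻¹ * (z * y)   ≈⟨ inv y ⟨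
    y                ∎)
    where
    inv : ∀ x → x ≈ z ⁻¹ * (z * x)
    inv x = begin-equality
      x                ≈⟨ *-identityˡ x ⟨
      1# * x           ≈⟨ *-congʳ (⁻¹-inverseʳ z z≉0) ⟨
      z * z ⁻¹ * x     ≈⟨ solve 3 (λ z i x → z :* i :* x := i :* (z :* x)) refl z (z ⁻¹) x ⟩
      z ⁻¹ * (z * x)   ∎

  1-≤1 : ∀ {x} → 0# ≤ x → 1# - x ≤ 1#
  1-≤1 {x} 0≤x = ≤-from-slack 0≤x (solve 1 (λ x → con (+ 1) := (con (+ 1) :- x) :+ x) refl x)

  1≤⇒≉0 : ∀ {x} → 1# ≤ x → ¬ (x ≈ 0#)
  1≤⇒≉0 1≤x x≈0 = 1≰0 (≤-respʳ-≈ x≈0 1≤x)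

  1≤2 : 1# ≤ 1# + 1#
  1≤2 = ≤-from-slack 0≤1 refl

  0≤2 : 0# ≤ 1# + 1#
  0≤2 = ≤-trans 0≤1 1≤2

  halve : ∀ {x y} → (1# + 1#) * x ≤ (1# + 1#) * y → x ≤ y
  halve = *-cancelˡ-≤ 0≤2 (1≤⇒≉0 1≤2)

  sum-mono : ∀ {n} {f g : Fin n → ℝ} → (∀ i → f i ≤ g i) → sum f ≤ sum g
  sum-mono {zero}  f≤g = ≤-refl
  sum-mono {suc n} f≤g = +-mono-≤ (f≤g Fin.zero) (sum-mono (f≤g ∘ Fin.suc))

  sum-nonNegative : ∀ {n} {f : Fin n → ℝ} → (∀ i → 0# ≤ f i) → 0# ≤ sum f
  sum-nonNegative {zero}  0≤f = ≤-refl
  sum-nonNegative {suc n} 0≤f = +-nonNegative (0≤f Fin.zero) (sum-nonNegative (0≤f ∘ Fin.suc))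

  term≤sum : ∀ {n} {f : Fin n → ℝ} → (∀ i → 0# ≤ f i) → ∀ i → f i ≤ sum f
  term≤sum {suc n} {f} 0≤f Fin.zero    =
    ≤-from-slack (sum-nonNegative (0≤f ∘ Fin.suc)) refl
  term≤sum {suc n} {f} 0≤f (Fin.suc i) = begin
    f (Fin.suc i)        ≤⟨ term≤sum (0≤f ∘ Fin.suc) i ⟩
    sum (f ∘ Fin.suc)    ≤⟨ ≤-from-slack (0≤f Fin.zero) (+-comm _ _) ⟩
    sum f                ∎

  sum-sub : ∀ {n} (f g : Fin n → ℝ) → sum (λ i → f i - g i) ≈ sum f - sum g
  sum-sub {zero}  f g = sym (-‿inverseʳ 0#)
  sum-sub {suc n} f g = trans (+-congˡ (sum-sub (f ∘ Fin.suc) (g ∘ Fin.suc)))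
    (solve 4 (λ a b c d → a :- b :+ (c :- d) := a :+ c :- (b :+ d)) refl _ _ _ _)

  -- Giving the leftover mass to index 0 makes a probability vector without a normalising constant,
  -- so the other weights stay exact powers.
  complete : ∀ {n} → (Fin n → ℝ) → Fin (suc n) → ℝ
  complete w Fin.zero    = 1# - sum w
  complete w (Fin.suc i) = w i

  complete-total : ∀ {n} (w : Fin n → ℝ) → sum (complete w) ≈ 1#
  complete-total w = solve 1 (λ W → con (+ 1) :- W :+ W := con (+ 1)) refl (sum w)

  complete-nonNegative : ∀ {n} {w : Fin n → ℝ} → (∀ i → 0# ≤ w i) → sum w ≤ 1# →
                         ∀ i → 0# ≤ complete w i
  complete-nonNegative 0≤w ∑w≤1 Fin.zero    = 0≤-diff ∑w≤1
  complete-nonNegative 0≤w ∑w≤1 (Fin.suc i) = 0≤w i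

-- Indicators of arbitrary events

module Indicators (em : ExcludedMiddle 0ℓ) (R : CompleteOrderedField) where

  open CompleteOrderedField R renaming (Carrier to ℝ)
  open OrderedFieldProperties R
  open Relation.Binary.Reasoning.PartialOrder poset

  𝟙 : Set → ℝ
  𝟙 P with em {P}
  ... | yes _ = 1#
  ... | no  _ = 0#

  𝟙-true : ∀ {P} → P → 𝟙 P ≈ 1#
  𝟙-true {P} p with em {P}
  ... | yes _  = refl
  ... | no  ¬p = ⊥-elim (¬p p)

  𝟙-false : ∀ {P} → ¬ P → 𝟙 P ≈ 0#
  𝟙-false {P} ¬p with em {P}
  ... | yes p = ⊥-elim (¬p p)
  ... | no  _ = refl

  𝟙-nonNegative : ∀ P → 0# ≤ 𝟙 P
  𝟙-nonNegative P with em {P}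
  ... | yes _ = 0≤1
  ... | no  _ = ≤-refl

  𝟙-≤1 : ∀ P → 𝟙 P ≤ 1#
  𝟙-≤1 P with em {P}
  ... | yes _ = ≤-refl
  ... | no  _ = 0≤1

  𝟙-cong : ∀ {P Q} → (P → Q) → (Q → P) → 𝟙 P ≈ 𝟙 Q
  𝟙-cong {P} {Q} P→Q Q→P with em {P}
  ... | yes p = sym (𝟙-true (P→Q p))
  ... | no ¬p = sym (𝟙-false (¬p ∘ Q→P))

  -- At most one summand survives. Once an index has hit, the induction continues with the bound 0,
  -- because a second hit would contradict disjointness; for this `0# ≤ b` is kept separate from the
  -- bounds on `a`.
  disjoint-sum-≤ : ∀ {n} (a : Fin n → ℝ) (A : Fin n → Set) {b} →
                   (∀ {i j} → i ≢ j → A i → A j → ⊥) → 0# ≤ b →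
                   (∀ i → A i → a i ≤ b) → sum (λ i → a i * 𝟙 (A i)) ≤ b
  disjoint-sum-≤ {zero}  a A disj 0≤b a≤b = 0≤b
  disjoint-sum-≤ {suc n} a A {b} disj 0≤b a≤b with em {A Fin.zero}
  ... | yes p = begin
    a Fin.zero * 1# + sum (λ i → a (Fin.suc i) * 𝟙 (A (Fin.suc i)))
      ≤⟨ +-monoʳ-≤ _ (disjoint-sum-≤ (a ∘ Fin.suc) (A ∘ Fin.suc)
           (λ i≢j → disj (i≢j ∘ Fin.suc-injective)) ≤-refl
           (λ i q → ⊥-elim (disj (λ ()) p q))) ⟩
    a Fin.zero * 1# + 0#
      ≈⟨ trans (+-identityʳ _) (*-identityʳ _) ⟩
    a Fin.zero
      ≤⟨ a≤b Fin.zero p ⟩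
    b ∎
  ... | no ¬p = begin
    a Fin.zero * 0# + sum (λ i → a (Fin.suc i) * 𝟙 (A (Fin.suc i)))
      ≈⟨ trans (+-congʳ (zeroʳ _)) (+-identityˡ _) ⟩
    sum (λ i → a (Fin.suc i) * 𝟙 (A (Fin.suc i)))
      ≤⟨ disjoint-sum-≤ (a ∘ Fin.suc) (A ∘ Fin.suc)
           (λ i≢j → disj (i≢j ∘ Fin.suc-injective)) 0≤b (λ i → a≤b (Fin.suc i)) ⟩
    b ∎

-- Series as suprema of partial sums

module Series (R : CompleteOrderedField) where

  open CompleteOrderedField R renaming (Carrier to ℝ)
  open ProphetInequality R
  open OrderedFieldProperties R
  open Relation.Binary.Reasoning.PartialOrder poset

  partialSum-mono : ∀ {f : ℕ → ℝ} → (∀ k → 0# ≤ f k) → ∀ {m n} → m ℕ.≤ n →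
                    partialSum f m ≤ partialSum f n
  partialSum-mono {f} 0≤f {n = n} ℕ.z≤n = sum-nonNegative {n} {f ∘ toℕ} (λ i → 0≤f (toℕ i))
  partialSum-mono 0≤f (ℕ.s≤s m≤n)   = +-monoʳ-≤ _ (partialSum-mono (0≤f ∘ suc) m≤n)

  IsLub-unique : ∀ {S : Pred ℝ (Level.suc 0ℓ)} {s t} → IsLub _≤_ S s → IsLub _≤_ S t → s ≈ t
  IsLub-unique (ub , least) (ub′ , least′) = ≤-antisym (least _ ub′) (least′ _ ub)

  partialSums-lub-cong : ∀ {f g : ℕ → ℝ} {s t} → (∀ k → f k ≈ g k) → s ≈ t →
                         IsLub _≤_ (PartialSums f) s → IsLub _≤_ (PartialSums g) t
  partialSums-lub-cong f≈g s≈t (ub , least) =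
    (λ x (lift (n , x≈)) → ≤-respʳ-≈ s≈t
      (ub x (lift (n , trans x≈ (sym (sum-cong-≋ {n} (λ i → f≈g (toℕ i)))))))) ,
    (λ b isUb → ≤-respˡ-≈ s≈t (least b λ x (lift (n , x≈)) →
      isUb x (lift (n , trans x≈ (sum-cong-≋ {n} (λ i → f≈g (toℕ i)))))))

  ∑∞-isLub : ∀ (f : ℕ → ℝ) {b} → UpperBound _≤_ (PartialSums f) b → IsLub _≤_ (PartialSums f) (∑∞ f)
  ∑∞-isLub f isUb = sup-isLub _ (0# , lift (0 , refl)) (_ , isUb)

  ∑∞-unique : ∀ (f : ℕ → ℝ) {s} → IsLub _≤_ (PartialSums f) s → ∑∞ f ≈ s
  ∑∞-unique f lub = IsLub-unique (∑∞-isLub f (proj₁ lub)) lub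

  eventually-all : ∀ {n} (P : Fin n → ℕ → Set) →
                   (∀ i → ∃[ N ] ∀ {M} → N ℕ.≤ M → P i M) →
                   ∃[ N ] ∀ i {M} → N ℕ.≤ M → P i M
  eventually-all {zero}  P h = 0 , λ ()
  eventually-all {suc n} P h with h Fin.zero | eventually-all (P ∘ Fin.suc) (h ∘ Fin.suc)
  ... | N₀ , p₀ | N₁ , p₁ = N₀ ℕ.⊔ N₁ , λ where
    Fin.zero    N≤M → p₀ (ℕ.≤-trans (ℕ.m≤m⊔n N₀ N₁) N≤M)
    (Fin.suc i) N≤M → p₁ i (ℕ.≤-trans (ℕ.m≤n⊔m N₀ N₁) N≤M)

  partialSum-mixture : ∀ {m} (w : Fin m → ℝ) (φ : Fin m → ℕ → ℝ) n →
                       partialSum (λ h → sum (λ i → w i * φ i h)) n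
                         ≈ sum (λ i → w i * partialSum (φ i) n)
  partialSum-mixture w φ n = trans
    (∑-comm {n} (λ h i → w i * φ i (toℕ h)))
    (sum-cong-≋ (λ i → sym (*-distribˡ-sum {n} (w i) (φ i ∘ toℕ))))

  -- Each `φ i` attains its total `c i` after finitely many terms, so a common index attains the
  -- total of the mixture and no limits are interchanged. It yields both expectations under a
  -- finitely supported law and σ-additivity of a finite space: in each case the `φ i` are disjoint
  -- indicators, up to a factor.
  mixture-lub : ∀ {m} (w : Fin m → ℝ) (φ : Fin m → ℕ → ℝ) (c : Fin m → ℝ) →
                (∀ i → 0# ≤ w i) → (∀ i k → 0# ≤ φ i k) →
                (∀ i n → partialSum (φ i) n ≤ c i) →
                (∀ i → ∃[ n ] c i ≤ partialSum (φ i) n) →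
                IsLub _≤_ (PartialSums (λ h → sum (λ i → w i * φ i h)))
                  (sum (λ i → w i * c i))
  mixture-lub w φ c 0≤w 0≤φ φ≤c c≤φ = isUb , least
    where
    isUb : UpperBound _≤_ (PartialSums (λ h → sum (λ i → w i * φ i h))) (sum (λ i → w i * c i))
    isUb x (lift (n , x≈)) = begin
      x                                            ≈⟨ trans x≈ (partialSum-mixture w φ n) ⟩
      sum (λ i → w i * partialSum (φ i) n)         ≤⟨ sum-mono (λ i → *-monoˡ-≤ (0≤w i) (φ≤c i n)) ⟩
      sum (λ i → w i * c i)                        ∎
    least : ∀ b → UpperBound _≤_ (PartialSums (λ h → sum (λ i → w i * φ i h))) b →
            sum (λ i → w i * c i) ≤ b
    least b isUb with eventually-all (λ i n → c i ≤ partialSum (φ i) n)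
      (λ i → proj₁ (c≤φ i) , λ N≤M → ≤-trans (proj₂ (c≤φ i)) (partialSum-mono (0≤φ i) N≤M))
    ... | N , c≤ = begin
      sum (λ i → w i * c i)                        ≤⟨ sum-mono (λ i → *-monoˡ-≤ (0≤w i) (c≤ i ℕ.≤-refl)) ⟩
      sum (λ i → w i * partialSum (φ i) N)         ≈⟨ partialSum-mixture w φ N ⟨
      partialSum (λ h → sum (λ i → w i * φ i h)) N ≤⟨ isUb _ (lift (N , refl)) ⟩
      b                                            ∎

  term≤partialSum : ∀ {f : ℕ → ℝ} → (∀ k → 0# ≤ f k) → ∀ k → f k ≤ partialSum f (suc k)
  term≤partialSum 0≤f zero    = ≤-reflexive (sym (+-identityʳ _))
  term≤partialSum {f} 0≤f (suc k) = begin
    f (suc k)                       ≤⟨ term≤partialSum (0≤f ∘ suc) k ⟩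
    partialSum (f ∘ suc) (suc k)    ≤⟨ ≤-from-slack (0≤f 0) (+-comm _ _) ⟩
    partialSum f (suc (suc k))      ∎

-- Finitely supported laws and finite probability spaces

module FiniteMixtures (em : ExcludedMiddle 0ℓ) (R : CompleteOrderedField) where

  open CompleteOrderedField R renaming (Carrier to ℝ)
  open ProphetInequality R
  open OrderedFieldProperties R
  open Indicators em R
  open Series R
  open Relation.Binary.Reasoning.PartialOrder poset

  module FiniteLaw {m} (w : Fin m → ℝ) (0≤w : ∀ i → 0# ≤ w i) (η : Fin m → ℕ) where

    law : ℕ → ℝ
    law h = sum (λ i → w i * 𝟙 (η i ≡ h))

    law-lub : ∀ {g : ℕ → ℝ} → (∀ k → 0# ≤ g k) →
              IsLub _≤_ (PartialSums (λ h → law h * g h)) (sum (λ i → w i * g (η i)))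
    law-lub {g} 0≤g = partialSums-lub-cong {f = λ h → sum (λ i → w i * φ i h)} rearrange refl
      (mixture-lub w φ (g ∘ η) 0≤w 0≤φ φ≤ ≤φ)
      where
      φ : Fin m → ℕ → ℝ
      φ i h = g h * 𝟙 (η i ≡ h)
      0≤φ : ∀ i k → 0# ≤ φ i k
      0≤φ i k = *-nonNegative (0≤g k) (𝟙-nonNegative _)
      rearrange : ∀ h → sum (λ i → w i * φ i h) ≈ law h * g h
      rearrange h = trans
        (sum-cong-≋ {m} (λ i → trans (*-congˡ (*-comm _ _)) (sym (*-assoc _ _ _))))
        (sym (*-distribʳ-sum {m} (g h) _))
      φ≤ : ∀ i n → partialSum (φ i) n ≤ g (η i)
      φ≤ i n = disjoint-sum-≤ {n} (g ∘ toℕ) (λ k → η i ≡ toℕ k)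
        (λ k≢l ηi≡k ηi≡l → k≢l (Fin.toℕ-injective (≡.trans (≡.sym ηi≡k) ηi≡l)))
        (0≤g _) (λ k ηi≡k → ≤-reflexive (reflexive (≡.cong g (≡.sym ηi≡k))))
      ≤φ : ∀ i → ∃[ n ] g (η i) ≤ partialSum (φ i) n
      ≤φ i = suc (η i) , ≤-trans
        (≤-reflexive (sym (trans (*-congˡ (𝟙-true ≡.refl)) (*-identityʳ _))))
        (term≤partialSum (0≤φ i) (η i))

    𝔼-law : ∀ {g : ℕ → ℝ} → (∀ k → 0# ≤ g k) → 𝔼⟨ law ⟩ g ≈ sum (λ i → w i * g (η i))
    𝔼-law {g} 0≤g = ∑∞-unique (λ h → law h * g h) (law-lub 0≤g)

    horizon : sum w ≈ 1# → (∀ i → η i ≢ 0) → Horizon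
    horizon ∑w≈1 η≢0 = record
      { pmf         = law
      ; pmf-nonNeg  = λ h → sum-nonNegative {m} (λ i → *-nonNegative (0≤w i) (𝟙-nonNegative _))
      ; pmf-0       = trans (sum-cong-≋ {m} (λ i → trans (*-congˡ (𝟙-false (η≢0 i))) (zeroʳ _)))
                            (sum-replicate-zero m)
      ; pmf-total   = partialSums-lub-cong {f = λ h → law h * 1#} (λ h → *-identityʳ _)
                        (trans (sum-cong-≋ {m} (λ i → *-identityʳ _)) ∑w≈1)
                        (law-lub (λ _ → 0≤1))
      ; mean-finite = _ , proj₁ (law-lub (λ k → ·-nonNegative k 0≤1))
      }

  module FiniteSpace {m} (p : Fin m → ℝ) (0≤p : ∀ ω → 0# ≤ p ω) (∑p≈1 : sum p ≈ 1#) where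

    prob : Pred (Fin m) 0ℓ → ℝ
    prob A = sum (λ ω → p ω * 𝟙 (A ω))

    space : ProbabilitySpace
    space = record
      { Ω            = Fin m
      ; Measurable   = λ _ → Lift _ ⊤
      ; measurable-≐ = λ _ _ → lift tt
      ; measurable-U = lift tt
      ; measurable-∁ = λ _ → lift tt
      ; measurable-⋃ = λ _ → lift tt
      ; ℙ            = prob
      ; ℙ-cong       = λ _ (A⊆B , B⊆A) → sum-cong-≋ {m} (λ ω → *-congˡ (𝟙-cong A⊆B B⊆A))
      ; ℙ-nonNeg     = λ _ → sum-nonNegative {m} (λ ω → *-nonNegative (0≤p ω) (𝟙-nonNegative _))
      ; ℙ-U          = trans (sum-cong-≋ {m} (λ ω → trans (*-congˡ (𝟙-true tt)) (*-identityʳ _))) ∑p≈1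
      ; ℙ-σ-additive = λ {A} _ disj → σ-additive A (λ i≢j Aiω Ajω → disj i≢j (Aiω , Ajω))
      }
      where
      σ-additive : ∀ (A : ℕ → Pred (Fin m) 0ℓ) →
                   (∀ {i j} → i ≢ j → ∀ {ω} → A i ω → A j ω → ⊥) →
                   IsLub _≤_ (PartialSums (prob ∘ A)) (prob (⋃ ℕ A))
      σ-additive A disj = mixture-lub p (λ ω i → 𝟙 (A i ω)) (λ ω → 𝟙 (⋃ ℕ A ω)) 0≤p
        (λ ω i → 𝟙-nonNegative _) upper attained
        where
        upper : ∀ ω n → partialSum (λ i → 𝟙 (A i ω)) n ≤ 𝟙 (⋃ ℕ A ω)
        upper ω n = begin
          partialSum (λ i → 𝟙 (A i ω)) n            ≈⟨ sum-cong-≋ {n} (λ i → *-identityˡ _) ⟨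
          sum {n} (λ i → 1# * 𝟙 (A (toℕ i) ω))      ≤⟨ disjoint-sum-≤ {n} (λ _ → 1#) (λ i → A (toℕ i) ω)
            (λ i≢j → disj (i≢j ∘ Fin.toℕ-injective)) (𝟙-nonNegative _)
            (λ i Aiω → ≤-reflexive (sym (𝟙-true (toℕ i , Aiω)))) ⟩
          𝟙 (⋃ ℕ A ω)                               ∎
        attained : ∀ ω → ∃[ n ] 𝟙 (⋃ ℕ A ω) ≤ partialSum (λ i → 𝟙 (A i ω)) n
        attained ω with em {⋃ ℕ A ω}
        ... | no  _         = 0 , ≤-refl
        ... | yes (i , Aiω) = suc i , ≤-trans (≤-reflexive (sym (𝟙-true Aiω)))
                                (term≤partialSum {λ k → 𝟙 (A k ω)} (λ k → 𝟙-nonNegative _) i)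

    open ProbabilitySpace space using (∫; ∫^; SimpleIntegralsBelow; Integrable)

    weighted : (Fin m → ℝ) → ℝ
    weighted f = sum (λ ω → p ω * f ω)

    weighted-mono : ∀ {f g} → (∀ ω → f ω ≤ g ω) → weighted f ≤ weighted g
    weighted-mono f≤g = sum-mono {m} (λ ω → *-monoˡ-≤ (0≤p ω) (f≤g ω))

    weighted-const : ∀ x → weighted (λ _ → x) ≈ x
    weighted-const x = trans (sym (*-distribʳ-sum {m} x p)) (trans (*-congʳ ∑p≈1) (*-identityˡ x))

    -- The supremum is attained by the decomposition of `f` over singletons. For any other simple
    -- function, exchanging the sums leaves at each outcome at most one coefficient, which lies
    -- below `f ω`.
    integral-isLub : ∀ {f} → (∀ ω → 0# ≤ f ω) → IsLub _≤_ (SimpleIntegralsBelow f) (weighted f)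
    integral-isLub {f} 0≤f = upper , least
      where
      upper : UpperBound _≤_ (SimpleIntegralsBelow f) (weighted f)
      upper s (n , a , A , _ , disj , 0≤a , a≤f , s≈) = begin
        s                                                    ≈⟨ s≈ ⟩
        sum (λ i → a i * sum (λ ω → p ω * 𝟙 (A i ω)))        ≈⟨ sum-cong-≋ {n} (λ i → *-distribˡ-sum {m} (a i) _) ⟩
        sum (λ i → sum (λ ω → a i * (p ω * 𝟙 (A i ω))))      ≈⟨ ∑-comm (λ i ω → a i * (p ω * 𝟙 (A i ω))) ⟩
        sum (λ ω → sum (λ i → a i * (p ω * 𝟙 (A i ω))))      ≈⟨ sum-cong-≋ {m} (λ ω → trans
          (sum-cong-≋ {n} (λ i → solve 3 (λ a p x → a :* (p :* x) := p :* (a :* x)) refl (a i) (p ω) _))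
          (sym (*-distribˡ-sum {n} (p ω) _))) ⟩
        sum (λ ω → p ω * sum (λ i → a i * 𝟙 (A i ω)))        ≤⟨ weighted-mono (λ ω →
          disjoint-sum-≤ a (λ i → A i ω) (λ i≢j Aiω Ajω → disj i≢j (Aiω , Ajω)) (0≤f ω) (λ i → a≤f i ω)) ⟩
        weighted f                                           ∎
      least : ∀ b → UpperBound _≤_ (SimpleIntegralsBelow f) b → weighted f ≤ b
      least b isUb = begin
        weighted f                              ≤⟨ sum-mono {m} (λ ω → ≤-trans (≤-reflexive (*-comm _ _))
                                                     (*-monoˡ-≤ (0≤f ω) (p≤prob ω))) ⟩
        sum (λ ω → f ω * prob (_≡ ω))           ≤⟨ isUb _ (m , f , (λ ω → _≡ ω) , (λ _ → lift tt) ,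
          (λ i≢j (x≡i , x≡j) → i≢j (≡.trans (≡.sym x≡i) x≡j)) , 0≤f ,
          (λ i ω ω≡i → ≤-reflexive (reflexive (≡.cong f (≡.sym ω≡i)))) , refl) ⟩
        b                                       ∎
        where
        p≤prob : ∀ ω → p ω ≤ prob (_≡ ω)
        p≤prob ω = begin
          p ω                   ≈⟨ trans (*-congˡ (𝟙-true ≡.refl)) (*-identityʳ _) ⟨
          p ω * 𝟙 (ω ≡ ω)       ≤⟨ term≤sum {m} (λ ω′ → *-nonNegative (0≤p ω′) (𝟙-nonNegative (ω′ ≡ ω))) ω ⟩
          prob (_≡ ω)           ∎

    integrable : ∀ {f} → (∀ ω → 0# ≤ f ω) → Integrable f
    integrable 0≤f = _ , proj₁ (integral-isLub 0≤f)

    ∫-weighted : ∀ {f} → (∀ ω → 0# ≤ f ω) → ∫ f ≈ weighted f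
    ∫-weighted {f} 0≤f = IsLub-unique
      -- The empty simple function witnesses that the set of integrals is inhabited.
      (sup-isLub _ (0# , 0 , (λ ()) , (λ ()) , (λ ()) , (λ { {()} }) , (λ ()) , (λ ()) , refl)
        (integrable 0≤f))
      (integral-isLub 0≤f)

    weighted-nonNegative : ∀ {f} → (∀ ω → 0# ≤ f ω) → 0# ≤ weighted f
    weighted-nonNegative 0≤f = sum-nonNegative {m} (λ ω → *-nonNegative (0≤p ω) (0≤f ω))

    ∫^-nonNegative : ∀ h {F : Vec (Fin m) h → ℝ} → (∀ ωs → 0# ≤ F ωs) → 0# ≤ ∫^ h F
    ∫^-nonNegative zero    0≤F = 0≤F []
    ∫^-nonNegative (suc h) 0≤F =
      ≤-respʳ-≈ (sym (∫-weighted 0≤∫)) (weighted-nonNegative 0≤∫)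
      where 0≤∫ = λ ω → ∫^-nonNegative h (λ ωs → 0≤F (ω ∷ ωs))

    ∫^-suc : ∀ h {F : Vec (Fin m) (suc h) → ℝ} → (∀ ωs → 0# ≤ F ωs) →
             ∫^ (suc h) F ≈ weighted (λ ω → ∫^ h (λ ωs → F (ω ∷ ωs)))
    ∫^-suc h 0≤F = ∫-weighted (λ ω → ∫^-nonNegative h (λ ωs → 0≤F (ω ∷ ωs)))

    ∫^-mono : ∀ h {F G : Vec (Fin m) h → ℝ} → (∀ ωs → 0# ≤ F ωs) → (∀ ωs → F ωs ≤ G ωs) →
              ∫^ h F ≤ ∫^ h G
    ∫^-mono zero    0≤F F≤G = F≤G []
    ∫^-mono (suc h) {F} {G} 0≤F F≤G = begin
      ∫^ (suc h) F                                  ≈⟨ ∫^-suc h 0≤F ⟩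
      weighted (λ ω → ∫^ h (λ ωs → F (ω ∷ ωs)))     ≤⟨ weighted-mono (λ ω →
        ∫^-mono h (λ ωs → 0≤F (ω ∷ ωs)) (λ ωs → F≤G (ω ∷ ωs))) ⟩
      weighted (λ ω → ∫^ h (λ ωs → G (ω ∷ ωs)))     ≈⟨ ∫^-suc h (λ ωs → ≤-trans (0≤F ωs) (F≤G ωs)) ⟨
      ∫^ (suc h) G                                  ∎

    ∫^-const : ∀ h {x} → 0# ≤ x → ∫^ h (λ _ → x) ≈ x
    ∫^-const zero    0≤x = refl
    ∫^-const (suc h) {x} 0≤x = trans (∫^-suc h (λ _ → 0≤x))
      (trans (sum-cong-≋ {m} (λ ω → *-congˡ (∫^-const h 0≤x))) (weighted-const x))

-- The threshold rule and the maximum along a sequence of values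

module Thresholds (R : CompleteOrderedField) where

  open CompleteOrderedField R renaming (Carrier to ℝ)
  open ProphetInequality R
  open OrderedFieldProperties R
  open Algebra.Construct.NaturalChoice.Max totalOrder using (x≤x⊔y; x≤y⊔x)

  Y-τ-stop : ∀ {π x h} (xs : Vec ℝ h) → π ≤ x → Y-τ π (x ∷ xs) ≡ x
  Y-τ-stop {π} {x} xs π≤x with π ≤? x
  ... | yes _   = ≡.refl
  ... | no  π≰x = ⊥-elim (π≰x π≤x)

  Y-τ-pass : ∀ {π x h} (xs : Vec ℝ h) → ¬ (π ≤ x) → Y-τ π (x ∷ xs) ≡ Y-τ π xs
  Y-τ-pass {π} {x} xs π≰x with π ≤? x
  ... | yes π≤x = ⊥-elim (π≰x π≤x)
  ... | no  _ with τ π xs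
  ...   | just _  = ≡.refl
  ...   | nothing = ≡.refl

  head≤M : ∀ {h} x (xs : Vec ℝ h) → x ≤ M (x ∷ xs)
  head≤M x xs = x≤x⊔y x (M xs)

  tail≤M : ∀ {h} x (xs : Vec ℝ h) → M xs ≤ M (x ∷ xs)
  tail≤M x xs = x≤y⊔x x (M xs)

  M-nonNegative : ∀ {h} (xs : Vec ℝ h) → 0# ≤ M xs
  M-nonNegative []       = ≤-refl
  M-nonNegative (x ∷ xs) = ≤-trans (M-nonNegative xs) (tail≤M x xs)

-- Prophet and gambler at a fixed horizon, for finitely many values

module FiniteValues (em : ExcludedMiddle 0ℓ) (R : CompleteOrderedField) where

  open CompleteOrderedField R renaming (Carrier to ℝ)
  open ProphetInequality R
  open OrderedFieldProperties R
  open Indicators em R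
  open FiniteMixtures em R
  open Thresholds R
  open Relation.Binary.Reasoning.PartialOrder poset

  module FiniteValue
    {m} (p : Fin m → ℝ) (0≤p : ∀ ω → 0# ≤ p ω) (∑p≈1 : sum p ≈ 1#)
    (X : Fin m → ℝ) (0≤X : ∀ ω → 0# ≤ X ω) where

    open FiniteSpace p 0≤p ∑p≈1
    open ProbabilitySpace space using (∫^)

    value : Value
    value = record
      { space        = space
      ; X            = X
      ; X-measurable = λ _ → lift tt
      ; X-nonNeg     = 0≤X
      ; X-integrable = integrable 0≤X
      }

    maxReward : ℕ → ℝ
    maxReward h = ∫^ h (λ ωs → M (Vec.map X ωs))

    -- The second factor is the probability that outcome `ω` occurs among `h` draws. The induction
    -- conditions on the first draw: if it is `ω`, the maximum is at least `X ω`; otherwise the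
    -- maximum of the remaining draws is a lower bound.
    maxReward-lower : ∀ ω h → X ω * (1# - (1# - p ω) ^ h) ≤ maxReward h
    maxReward-lower ω zero = ≤-reflexive
      (solve 1 (λ v → v :* (con (+ 1) :- con (+ 1)) := con (+ 0)) refl (X ω))
    maxReward-lower ω (suc h) = begin
      X ω * (1# - (1# - p ω) * y)
        ≈⟨ solve 3 (λ v r y → v :* (con (+ 1) :- (con (+ 1) :- r) :* y) :=
             v :* (con (+ 1) :- y) :+ r :* (v :* y)) refl (X ω) (p ω) y ⟩
      ℓ + p ω * (X ω * y)
        ≤⟨ +-monoʳ-≤ ℓ (≤-trans
             (≤-reflexive (*-congˡ (sym (trans (*-congʳ (𝟙-true ≡.refl)) (*-identityˡ _)))))
             (term≤sum {m} {λ ω′ → p ω′ * (𝟙 (ω′ ≡ ω) * (X ω * y))}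
               (λ ω′ → *-nonNegative (0≤p ω′) (*-nonNegative (𝟙-nonNegative _) 0≤Xy)) ω)) ⟩
      ℓ + weighted (λ ω′ → 𝟙 (ω′ ≡ ω) * (X ω * y))
        ≈⟨ +-congʳ (weighted-const ℓ) ⟨
      weighted (λ _ → ℓ) + weighted (λ ω′ → 𝟙 (ω′ ≡ ω) * (X ω * y))
        ≈⟨ ∑-distrib-+ {m} _ _ ⟨
      sum (λ ω′ → p ω′ * ℓ + p ω′ * (𝟙 (ω′ ≡ ω) * (X ω * y)))
        ≈⟨ sum-cong-≋ {m} (λ ω′ → distribˡ (p ω′) _ _) ⟨
      weighted (λ ω′ → ℓ + 𝟙 (ω′ ≡ ω) * (X ω * y))
        ≤⟨ weighted-mono first ⟩
      weighted (λ ω′ → ∫^ h (λ ωs → M (X ω′ ∷ Vec.map X ωs)))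
        ≈⟨ ∫^-suc h (λ ωs → M-nonNegative (Vec.map X ωs)) ⟨
      maxReward (suc h) ∎
      where
      y = (1# - p ω) ^ h
      ℓ = X ω * (1# - y)
      p≤1 : p ω ≤ 1#
      p≤1 = ≤-respʳ-≈ ∑p≈1 (term≤sum {m} 0≤p ω)
      0≤Xy : 0# ≤ X ω * y
      0≤Xy = *-nonNegative (0≤X ω) (^-nonNegative (0≤-diff p≤1) h)
      first : ∀ ω′ → ℓ + 𝟙 (ω′ ≡ ω) * (X ω * y) ≤ ∫^ h (λ ωs → M (X ω′ ∷ Vec.map X ωs))
      first ω′ with em {ω′ ≡ ω}
      ... | yes ≡.refl = begin
        ℓ + 1# * (X ω * y)                          ≈⟨ solve 2 (λ v y → v :* (con (+ 1) :- y) :+ con (+ 1) :* (v :* y) := v) refl (X ω) y ⟩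
        X ω                                         ≈⟨ ∫^-const h (0≤X ω) ⟨
        ∫^ h (λ _ → X ω)                            ≤⟨ ∫^-mono h (λ _ → 0≤X ω) (λ ωs → head≤M (X ω) (Vec.map X ωs)) ⟩
        ∫^ h (λ ωs → M (X ω ∷ Vec.map X ωs))        ∎
      ... | no _ = begin
        ℓ + 0# * (X ω * y)                          ≈⟨ trans (+-congˡ (zeroˡ _)) (+-identityʳ ℓ) ⟩
        ℓ                                           ≤⟨ maxReward-lower ω h ⟩
        maxReward h                                 ≤⟨ ∫^-mono h (λ ωs → M-nonNegative (Vec.map X ωs)) (λ ωs → tail≤M (X ω′) (Vec.map X ωs)) ⟩
        ∫^ h (λ ωs → M (X ω′ ∷ Vec.map X ωs))       ∎

    module Threshold (π : ℝ) where

      u : Fin m → ℝ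
      u ω = 𝟙 (π ≤ X ω)

      -- ℙ(X ≥ π) and 𝔼[X; X ≥ π]
      q s : ℝ
      q = weighted u
      s = weighted (λ ω → u ω * X ω)

      reward : ℕ → ℝ
      reward h = ∫^ h (λ ωs → Y-τ π (Vec.map X ωs))

      Y-τ-nonNegative : ∀ {h} (ωs : Vec (Fin m) h) → 0# ≤ Y-τ π (Vec.map X ωs)
      Y-τ-nonNegative []       = ≤-refl
      Y-τ-nonNegative (ω ∷ ωs) = go (π ≤? X ω)
        where
        go : Dec (π ≤ X ω) → 0# ≤ Y-τ π (X ω ∷ Vec.map X ωs)
        go (yes π≤X) = ≡.subst (0# ≤_) (≡.sym (Y-τ-stop (Vec.map X ωs) π≤X)) (0≤X ω)
        go (no  π≰X) = ≡.subst (0# ≤_) (≡.sym (Y-τ-pass (Vec.map X ωs) π≰X)) (Y-τ-nonNegative ωs)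

      reward-nonNegative : ∀ h → 0# ≤ reward h
      reward-nonNegative h = ∫^-nonNegative h Y-τ-nonNegative

      -- A renewal equation: the first value is either taken or rejected, and after a rejection the
      -- rule restarts with one step fewer. Both upper bounds on `reward`, by h s and by s / q, are
      -- inductions on it.
      reward-suc : ∀ h → reward (suc h) ≈ s + (1# - q) * reward h
      reward-suc h = begin-equality
        reward (suc h)
          ≈⟨ ∫^-suc h Y-τ-nonNegative ⟩
        weighted (λ ω → ∫^ h (λ ωs → Y-τ π (X ω ∷ Vec.map X ωs)))
          ≈⟨ sum-cong-≋ {m} (λ ω → *-congˡ (first ω)) ⟩
        sum (λ ω → p ω * (u ω * X ω + (1# - u ω) * r))
          ≈⟨ sum-cong-≋ {m} (λ ω → solve 4 (λ p u x r →
               p :* (u :* x :+ (con (+ 1) :- u) :* r) := p :* (u :* x) :+ (p :* r :- p :* u :* r))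
               refl (p ω) (u ω) (X ω) r) ⟩
        sum (λ ω → p ω * (u ω * X ω) + (p ω * r - p ω * u ω * r))
          ≈⟨ trans (∑-distrib-+ {m} _ _) (+-congˡ (sum-sub {m} _ _)) ⟩
        s + (weighted (λ _ → r) - sum (λ ω → p ω * u ω * r))
          ≈⟨ +-congˡ (+-cong (weighted-const r) (-‿cong (sym (*-distribʳ-sum {m} r _)))) ⟩
        s + (r - q * r)
          ≈⟨ solve 3 (λ s r q → s :+ (r :- q :* r) := s :+ (con (+ 1) :- q) :* r) refl s r q ⟩
        s + (1# - q) * r ∎
        where
        r = reward h
        ∫^-cong : ∀ {F G : Vec (Fin m) h → ℝ} → (∀ ωs → 0# ≤ G ωs) →
                  (∀ ωs → F ωs ≡ G ωs) → ∫^ h F ≈ ∫^ h G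
        ∫^-cong 0≤G F≡G = ≤-antisym
          (∫^-mono h (λ ωs → ≡.subst (0# ≤_) (≡.sym (F≡G ωs)) (0≤G ωs)) (λ ωs → ≤-reflexive (reflexive (F≡G ωs))))
          (∫^-mono h 0≤G (λ ωs → ≤-reflexive (reflexive (≡.sym (F≡G ωs)))))
        first : ∀ ω → ∫^ h (λ ωs → Y-τ π (X ω ∷ Vec.map X ωs)) ≈ u ω * X ω + (1# - u ω) * r
        first ω with em {π ≤ X ω}
        ... | yes π≤X = begin-equality
          ∫^ h (λ ωs → Y-τ π (X ω ∷ Vec.map X ωs))
            ≈⟨ ∫^-cong (λ _ → 0≤X ω) (λ ωs → Y-τ-stop (Vec.map X ωs) π≤X) ⟩
          ∫^ h (λ _ → X ω)
            ≈⟨ ∫^-const h (0≤X ω) ⟩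
          X ω
            ≈⟨ solve 2 (λ x r → x := con (+ 1) :* x :+ (con (+ 1) :- con (+ 1)) :* r) refl (X ω) r ⟩
          1# * X ω + (1# - 1#) * r ∎
        ... | no  π≰X = begin-equality
          ∫^ h (λ ωs → Y-τ π (X ω ∷ Vec.map X ωs))
            ≈⟨ ∫^-cong Y-τ-nonNegative (λ ωs → Y-τ-pass (Vec.map X ωs) π≰X) ⟩
          r
            ≈⟨ solve 2 (λ x r → r := con (+ 0) :* x :+ (con (+ 1) :- con (+ 0)) :* r) refl (X ω) r ⟩
          0# * X ω + (1# - 0#) * r ∎

      0≤s : 0# ≤ s
      0≤s = weighted-nonNegative (λ ω → *-nonNegative (𝟙-nonNegative _) (0≤X ω))

      0≤q : 0# ≤ q
      0≤q = weighted-nonNegative (λ ω → 𝟙-nonNegative _)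

      q≤1 : q ≤ 1#
      q≤1 = ≤-respʳ-≈ (weighted-const 1#) (weighted-mono (λ ω → 𝟙-≤1 _))

      p≤q : ∀ ω → π ≤ X ω → p ω ≤ q
      p≤q ω π≤X = begin
        p ω         ≈⟨ trans (*-congˡ (𝟙-true π≤X)) (*-identityʳ _) ⟨
        p ω * u ω   ≤⟨ term≤sum {m} (λ ω → *-nonNegative (0≤p ω) (𝟙-nonNegative (π ≤ X ω))) ω ⟩
        q           ∎

      reward-≤-* : ∀ h → reward h ≤ (h · 1#) * s
      reward-≤-* zero    = ≤-reflexive (sym (zeroˡ s))
      reward-≤-* (suc h) = ≤-trans (≤-reflexive (reward-suc h))
        (≤-from-slack (+-nonNegative (0≤-diff (reward-≤-* h)) (*-nonNegative 0≤q (reward-nonNegative h)))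
          (solve 4 (λ s q r c → (con (+ 1) :+ c) :* s :=
            s :+ (con (+ 1) :- q) :* r :+ (c :* s :- r :+ q :* r)) refl s q (reward h) (h · 1#)))

      -- The bound s / q, which is the fixed point of the renewal equation, in a form that stays
      -- meaningful when `q` vanishes.
      q*reward-≤ : ∀ h → q * reward h ≤ s
      q*reward-≤ zero    = ≤-respˡ-≈ (sym (zeroʳ q)) 0≤s
      q*reward-≤ (suc h) = ≤-trans (≤-reflexive (*-congˡ (reward-suc h)))
        (≤-from-slack (*-nonNegative (0≤-diff q≤1) (0≤-diff (q*reward-≤ h)))
          (solve 3 (λ s q r → s := q :* (s :+ (con (+ 1) :- q) :* r) :+
            (con (+ 1) :- q) :* (s :- q :* r)) refl s q (reward h)))

      p*reward-≤ : ∀ ω → π ≤ X ω → ∀ h → p ω * reward h ≤ s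
      p*reward-≤ ω π≤X h = ≤-trans (*-monoʳ-≤ (reward-nonNegative h) (p≤q ω π≤X)) (q*reward-≤ h)

-- Domination of the geometric generating function

module GeometricDomination (R : CompleteOrderedField) where

  open CompleteOrderedField R renaming (Carrier to ℝ)
  open ProphetInequality R
  open OrderedFieldProperties R
  open Series R
  open Relation.Binary.Reasoning.PartialOrder poset

  module _ {t} (0≤t : 0# ≤ t) (t≤1 : t ≤ 1#) where

    -- With k = m + 1 and δ = 1 - t this bounds 1 - t^k by kδ / (1 + (k-1)δ/2), which agrees with it
    -- to second order at t = 1. The coefficient (k-1)/2 is at least k/4 exactly from k = 2 on,
    -- which gives `bernoulli₄`.
    bernoulli₂ : ∀ m → (1# - t ^ suc m) * (1# + 1# + (m · 1#) * (1# - t))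
                         ≤ (1# + 1#) * ((suc m · 1#) * (1# - t))
    bernoulli₂ zero = ≤-reflexive (solve 1 (λ t →
      (con (+ 1) :- t :* con (+ 1)) :* (con (+ 2) :+ con (+ 0) :* (con (+ 1) :- t)) :=
      con (+ 2) :* ((con (+ 1) :+ con (+ 0)) :* (con (+ 1) :- t))) refl t)
    bernoulli₂ (suc m) = halve (≤-from-slack
      (+-nonNegative
        (*-nonNegative (+-nonNegative 0≤1 0≤t) (0≤-diff (bernoulli₂ m)))
        (*-nonNegative (*-nonNegative (0≤-diff (^-≤1 0≤t t≤1 (suc m)))
          (+-nonNegative (·-nonNegative m 0≤1) 0≤2))
          (*-nonNegative (0≤-diff t≤1) (0≤-diff t≤1))))
      (solve 3 (λ t y c →
        con (+ 2) :* (con (+ 2) :* ((con (+ 1) :+ (con (+ 1) :+ c)) :* (con (+ 1) :- t))) :=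
        con (+ 2) :* ((con (+ 1) :- t :* y) :* (con (+ 2) :+ (con (+ 1) :+ c) :* (con (+ 1) :- t)))
        :+ ((con (+ 1) :+ t) :*
              (con (+ 2) :* ((con (+ 1) :+ c) :* (con (+ 1) :- t))
                :- (con (+ 1) :- y) :* (con (+ 2) :+ c :* (con (+ 1) :- t)))
            :+ ((con (+ 1) :- y) :* (c :+ con (+ 2))) :* ((con (+ 1) :- t) :* (con (+ 1) :- t))))
        refl t (t ^ suc m) (m · 1#)))

    -- 1 - tᵏ ≤ x / (1 + x / 4) for x = k (1 - t) and k = 2 + n; this fails
    -- for k = 1.
    bernoulli₄ : ∀ n → let x = (suc (suc n) · 1#) * (1# - t) in
                 (1# - t ^ suc (suc n)) * (4 ·′ 1# + x) ≤ (4 ·′ 1#) * x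
    bernoulli₄ n = ≤-from-slack
      (+-nonNegative
        (*-nonNegative 0≤2 (0≤-diff (bernoulli₂ (suc n))))
        (*-nonNegative (*-nonNegative (0≤-diff (^-≤1 0≤t t≤1 (suc (suc n)))) (·-nonNegative n 0≤1))
          (0≤-diff t≤1)))
      (solve 3 (λ t y c →
        con (+ 4) :* ((con (+ 1) :+ (con (+ 1) :+ c)) :* (con (+ 1) :- t)) :=
        (con (+ 1) :- y) :* (con (+ 4) :+ (con (+ 1) :+ (con (+ 1) :+ c)) :* (con (+ 1) :- t))
        :+ (con (+ 2) :*
              (con (+ 2) :* ((con (+ 1) :+ (con (+ 1) :+ c)) :* (con (+ 1) :- t))
                :- (con (+ 1) :- y) :* (con (+ 2) :+ (con (+ 1) :+ c) :* (con (+ 1) :- t)))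
            :+ ((con (+ 1) :- y) :* c) :* (con (+ 1) :- t)))
        refl t (t ^ suc (suc n)) (n · 1#))

    ^-antitone : ∀ {k l} → k ℕ.≤ l → t ^ l ≤ t ^ k
    ^-antitone {k} {l} k≤l = begin
      t ^ l                     ≡⟨ ≡.cong (t ^_) (ℕ.m+[n∸m]≡n k≤l) ⟨
      t ^ (k ℕ.+ (l ℕ.∸ k))     ≈⟨ ^-homo-* t k (l ℕ.∸ k) ⟩
      t ^ k * t ^ (l ℕ.∸ k)     ≤⟨ *-monoˡ-≤ (^-nonNegative 0≤t k) (^-≤1 0≤t t≤1 (l ℕ.∸ k)) ⟩
      t ^ k * 1#                ≈⟨ *-identityʳ _ ⟩
      t ^ k                     ∎

  -- With f = x / (1 + x / 4) this is Jensen's inequality for a concave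
  -- function, up to a constant absorbed by the smallness of the total weight.
  dilution : ∀ {n} (w x f : Fin n → ℝ) → (∀ i → 0# ≤ w i) →
             (∀ i → 0# ≤ x i * f i) → (8 ·′ 1#) * sum w ≤ 1# →
             (∀ i → f i * (4 ·′ 1# + x i) ≤ (4 ·′ 1#) * x i) →
             (∀ i j → x i * f j ≤ x i * f i + x j * f j) →
             let F = sum (λ i → w i * f i) ; N = sum (λ i → w i * x i) in
             F * (1# + N) ≤ N
  dilution {n} w x f 0≤w 0≤xf 8W≤1 f≤ cross = halve (halve (≤-from-slack
    (+-nonNegative slack₁ (+-nonNegative (*-nonNegative (·′1-nonNegative 4) slack₂)
      (*-nonNegative (0≤-diff 8W≤1) 0≤Q)))
    (solve 4 (λ F N Q W →
      con (+ 2) :* (con (+ 2) :* N) :=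
      con (+ 2) :* (con (+ 2) :* (F :* (con (+ 1) :+ N)))
      :+ ((con (+ 4) :* N :- (con (+ 4) :* F :+ Q))
          :+ (con (+ 4) :* (W :* Q :+ W :* Q :- N :* F)
          :+ (con (+ 1) :- con (+ 8) :* W) :* Q)))
      refl F N Q W)))
    where
    W F N Q : ℝ
    W = sum w
    F = sum (λ i → w i * f i)
    N = sum (λ i → w i * x i)
    Q = sum (λ i → w i * (x i * f i))
    0≤Q : 0# ≤ Q
    0≤Q = sum-nonNegative {n} (λ i → *-nonNegative (0≤w i) (0≤xf i))
    -- Averaging the hypothesis on `f` gives Q/4 ≤ N - F. With NF ≤ 2WQ from `slack₂` and 2W ≤ 1/4,
    -- the chain is NF ≤ Q/4 ≤ N - F.
    slack₁ : 0# ≤ (4 ·′ 1#) * N - ((4 ·′ 1#) * F + Q)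
    slack₁ = 0≤-diff (begin
      (4 ·′ 1#) * F + Q
        ≈⟨ +-congʳ (*-distribˡ-sum {n} (4 ·′ 1#) _) ⟩
      sum (λ i → (4 ·′ 1#) * (w i * f i)) + Q
        ≈⟨ ∑-distrib-+ {n} _ _ ⟨
      sum (λ i → (4 ·′ 1#) * (w i * f i) + w i * (x i * f i))
        ≤⟨ sum-mono {n} (λ i → ≤-trans
             (≤-reflexive (solve 3 (λ w x f → con (+ 4) :* (w :* f) :+ w :* (x :* f) :=
               w :* (f :* (con (+ 4) :+ x))) refl (w i) (x i) (f i)))
             (≤-trans (*-monoˡ-≤ (0≤w i) (f≤ i))
             (≤-reflexive (solve 2 (λ w x → w :* (con (+ 4) :* x) := con (+ 4) :* (w :* x))
               refl (w i) (x i))))) ⟩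
      sum (λ i → (4 ·′ 1#) * (w i * x i))
        ≈⟨ *-distribˡ-sum {n} (4 ·′ 1#) _ ⟨
      (4 ·′ 1#) * N ∎)
    -- NF is a double sum of mixed products `x i * f j`. Replacing each by two diagonal products
    -- costs 2WQ, where Chebyshev's sum inequality for similarly ordered sequences would give WQ.
    column : ∀ j → N * f j ≤ Q + W * (x j * f j)
    column j = begin
      N * f j
        ≈⟨ *-distribʳ-sum {n} (f j) _ ⟩
      sum (λ i → w i * x i * f j)
        ≤⟨ sum-mono {n} (λ i → ≤-trans (≤-reflexive (*-assoc _ _ _))
             (≤-trans (*-monoˡ-≤ (0≤w i) (cross i j)) (≤-reflexive (distribˡ _ _ _)))) ⟩
      sum (λ i → w i * (x i * f i) + w i * (x j * f j))
        ≈⟨ ∑-distrib-+ {n} _ _ ⟩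
      Q + sum (λ i → w i * (x j * f j))
        ≈⟨ +-congˡ (*-distribʳ-sum {n} (x j * f j) w) ⟨
      Q + W * (x j * f j) ∎
    slack₂ : 0# ≤ W * Q + W * Q - N * F
    slack₂ = 0≤-diff (begin
      N * F
        ≈⟨ *-distribˡ-sum {n} N _ ⟩
      sum (λ j → N * (w j * f j))
        ≤⟨ sum-mono {n} (λ j → ≤-trans
             (≤-reflexive (solve 3 (λ N w f → N :* (w :* f) := w :* (N :* f)) refl N (w j) (f j)))
             (≤-trans (*-monoˡ-≤ (0≤w j) (column j))
             (≤-reflexive (solve 4 (λ w Q W z → w :* (Q :+ W :* z) := w :* Q :+ W :* (w :* z))
               refl (w j) Q W (x j * f j))))) ⟩
      sum (λ j → w j * Q + W * (w j * (x j * f j)))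
        ≈⟨ ∑-distrib-+ {n} _ _ ⟩
      sum (λ j → w j * Q) + sum (λ j → W * (w j * (x j * f j)))
        ≈⟨ +-cong (*-distribʳ-sum {n} Q w) (*-distribˡ-sum {n} W _) ⟨
      W * Q + W * Q ∎)

  -- The sum telescopes. Phrasing it through the recursion rather than through powers lets the
  -- induction pass to the shifted sequence and covers the generating function and the level weights
  -- alike.
  geometric-partialSum : ∀ ρ (a : ℕ → ℝ) → (∀ k → 0# ≤ a k) → (∀ k → a (suc k) ≈ ρ * a k) →
                         ∀ n → (1# - ρ) * partialSum a n ≤ a 0
  geometric-partialSum ρ a 0≤a step zero    = ≤-respˡ-≈ (sym (zeroʳ _)) (0≤a 0)
  geometric-partialSum ρ a 0≤a step (suc n) = begin
    (1# - ρ) * (a 0 + partialSum (a ∘ suc) n)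
      ≈⟨ distribˡ _ _ _ ⟩
    (1# - ρ) * a 0 + (1# - ρ) * partialSum (a ∘ suc) n
      ≤⟨ +-monoʳ-≤ _ (geometric-partialSum ρ (a ∘ suc) (0≤a ∘ suc) (step ∘ suc) n) ⟩
    (1# - ρ) * a 0 + a 1
      ≈⟨ +-congˡ (step 0) ⟩
    (1# - ρ) * a 0 + ρ * a 0
      ≈⟨ solve 2 (λ ρ a → (con (+ 1) :- ρ) :* a :+ ρ :* a := a) refl ρ (a 0) ⟩
    a 0 ∎

  -- The geometric generating function is t / (t + μ(1 - t)), so the last hypothesis is the desired
  -- comparison with denominators cleared. Bounding the partial sums by `P` suffices: it makes the
  -- supremum meaningful and bounds it at once.
  pgf-geometric-≤ : ∀ {μ t P} → 1# ≤ μ → 0# < t → t < 1# →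
                    t ≤ (t + μ * (1# - t)) * P →
                    pgf (geometricPmf μ) t ≤ P
  pgf-geometric-≤ {μ} {t} {P} 1≤μ (0≤t , _) (t≤1 , t≉1) t≤ =
    proj₂ (∑∞-isLub (λ h → geometricPmf μ h * t ^ h) isUb) P isUb
    where
    θ ρ : ℝ
    θ = μ ⁻¹
    ρ = (1# - θ) * t
    0≤μ = ≤-trans 0≤1 1≤μ
    μ≉0 = 1≤⇒≉0 1≤μ
    μθ≈1 : μ * θ ≈ 1#
    μθ≈1 = ⁻¹-inverseʳ μ μ≉0
    0≤θ : 0# ≤ θ
    0≤θ = *-cancelˡ-≤ 0≤μ μ≉0 (begin
      μ * 0#  ≈⟨ zeroʳ μ ⟩
      0#      ≤⟨ 0≤1 ⟩
      1#      ≈⟨ μθ≈1 ⟨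
      μ * θ   ∎)
    θ≤1 : θ ≤ 1#
    θ≤1 = *-cancelˡ-≤ 0≤μ μ≉0 (begin
      μ * θ   ≈⟨ μθ≈1 ⟩
      1#      ≤⟨ 1≤μ ⟩
      μ       ≈⟨ *-identityʳ μ ⟨
      μ * 1#  ∎)
    a : ℕ → ℝ
    a k = θ * (1# - θ) ^ k * (t * t ^ k)
    0≤a : ∀ k → 0# ≤ a k
    0≤a k = *-nonNegative (*-nonNegative 0≤θ (^-nonNegative (0≤-diff θ≤1) k))
      (*-nonNegative 0≤t (^-nonNegative 0≤t k))
    1-t≤1-ρ : 1# - t ≤ 1# - ρ
    1-t≤1-ρ = ≤-from-slack (*-nonNegative 0≤θ 0≤t)
      (solve 2 (λ t θ → con (+ 1) :- (con (+ 1) :- θ) :* t := con (+ 1) :- t :+ θ :* t) refl t θ)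
    1-ρ≉0 : ¬ (1# - ρ ≈ 0#)
    1-ρ≉0 1-ρ≈0 = t≉1 (≤-antisym t≤1 (≤-from-slack (0≤-diff (≤-respʳ-≈ 1-ρ≈0 1-t≤1-ρ))
      (solve 1 (λ t → t := con (+ 1) :+ (con (+ 0) :- (con (+ 1) :- t))) refl t)))
    θt≤ : θ * t ≤ (1# - ρ) * P
    θt≤ = *-cancelˡ-≤ 0≤μ μ≉0 (begin
      μ * (θ * t)                 ≈⟨ trans (sym (*-assoc _ _ _)) (trans (*-congʳ μθ≈1) (*-identityˡ t)) ⟩
      t                           ≤⟨ t≤ ⟩
      (t + μ * (1# - t)) * P      ≈⟨ *-congʳ (+-congʳ (trans (sym (*-identityˡ t)) (*-congʳ (sym μθ≈1)))) ⟩
      (μ * θ * t + μ * (1# - t)) * P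
        ≈⟨ solve 4 (λ μ θ t P → (μ :* θ :* t :+ μ :* (con (+ 1) :- t)) :* P :=
             μ :* ((con (+ 1) :- (con (+ 1) :- θ) :* t) :* P)) refl μ θ t P ⟩
      μ * ((1# - ρ) * P)          ∎)
    tail≤P : ∀ n → partialSum a n ≤ P
    tail≤P n = *-cancelˡ-≤ (≤-trans (0≤-diff t≤1) 1-t≤1-ρ) 1-ρ≉0 (begin
      (1# - ρ) * partialSum a n
        ≤⟨ geometric-partialSum ρ a 0≤a (λ k → solve 4 (λ θ t y z →
             θ :* ((con (+ 1) :- θ) :* y) :* (t :* (t :* z)) :=
             (con (+ 1) :- θ) :* t :* (θ :* y :* (t :* z))) refl θ t ((1# - θ) ^ k) (t ^ k)) n ⟩
      θ * 1# * (t * 1#)   ≈⟨ *-cong (*-identityʳ θ) (*-identityʳ t) ⟩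
      θ * t               ≤⟨ θt≤ ⟩
      (1# - ρ) * P        ∎)
    isUb : UpperBound _≤_ (PartialSums (λ h → geometricPmf μ h * t ^ h)) P
    isUb x (lift (zero , x≈))  = ≤-trans (≤-reflexive x≈) (tail≤P 0)
    isUb x (lift (suc n , x≈)) = begin
      x                            ≈⟨ x≈ ⟩
      0# * 1# + partialSum a n     ≈⟨ trans (+-congʳ (zeroˡ 1#)) (+-identityˡ _) ⟩
      partialSum a n               ≤⟨ tail≤P n ⟩
      P                            ∎

-- Horizons equal to one with probability at least 7/8

module MostlyOneHorizons (em : ExcludedMiddle 0ℓ) (R : CompleteOrderedField) where

  open CompleteOrderedField R renaming (Carrier to ℝ)
  open ProphetInequality R
  open OrderedFieldProperties R
  open FiniteMixtures em R
  open GeometricDomination R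
  open Relation.Binary.Reasoning.PartialOrder poset

  module MostlyOne
    {K} (w : Fin K → ℝ) (0≤w : ∀ i → 0# ≤ w i)
    (8W≤1 : (8 ·′ 1#) * sum w ≤ 1#) (e : Fin K → ℕ) where

    w⁺ : Fin (suc K) → ℝ
    w⁺ = complete w

    -- The offset 3 keeps H - 1 at 2 or more outside index 0, the range of `bernoulli₄`.
    η : Fin (suc K) → ℕ
    η Fin.zero    = 1
    η (Fin.suc i) = 3 ℕ.+ e i

    ∑w≤1 : sum w ≤ 1#
    ∑w≤1 = ≤-trans (≤-from-slack (*-nonNegative (·′1-nonNegative 7) (sum-nonNegative {K} 0≤w))
      (solve 1 (λ W → con (+ 8) :* W := W :+ con (+ 7) :* W) refl (sum w))) 8W≤1

    0≤w⁺ : ∀ i → 0# ≤ w⁺ i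
    0≤w⁺ = complete-nonNegative 0≤w ∑w≤1

    η≢0 : ∀ i → η i ≢ 0
    η≢0 Fin.zero    ()
    η≢0 (Fin.suc i) ()

    open FiniteLaw w⁺ 0≤w⁺ η public using (𝔼-law)
    open FiniteLaw w⁺ 0≤w⁺ η using (horizon)

    H : Horizon
    H = horizon (complete-total w) η≢0

    open Horizon H using (mean; pmf)

    ν : ℝ
    ν = sum (λ i → w i * (suc (suc (e i)) · 1#))

    mean≈1+ν : mean ≈ 1# + ν
    mean≈1+ν = begin-equality
      mean
        ≈⟨ 𝔼-law (λ k → ·-nonNegative k 0≤1) ⟩
      (1# - sum w) * (1# + 0#) + sum (λ i → w i * (1# + c i))
        ≈⟨ +-congˡ (trans (sum-cong-≋ {K} (λ i → trans (distribˡ _ _ _) (+-congʳ (*-identityʳ _))))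
             (∑-distrib-+ {K} w _)) ⟩
      (1# - sum w) * (1# + 0#) + (sum w + ν)
        ≈⟨ solve 2 (λ W ν → (con (+ 1) :- W) :* (con (+ 1) :+ con (+ 0)) :+ (W :+ ν) :=
             con (+ 1) :+ ν) refl (sum w) ν ⟩
      1# + ν ∎
      where
      c : Fin K → ℝ
      c i = suc (suc (e i)) · 1#

    H∈Ḡ : Ḡ H
    H∈Ḡ t 0<t@(0≤t , _) t<1@(t≤1 , _) = pgf-geometric-≤ 1≤mean 0<t t<1 (begin
      t
        ≤⟨ ≤-from-slack (*-nonNegative 0≤t (0≤-diff F[1+N]≤N))
             (solve 3 (λ t F N → t :* ((con (+ 1) :+ N) :* (con (+ 1) :- F)) :=
               t :+ t :* (N :- F :* (con (+ 1) :+ N))) refl t F N) ⟩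
      t * ((1# + N) * (1# - F))
        ≈⟨ *-congˡ (*-congʳ (+-congˡ N≈νδ)) ⟩
      t * ((1# + ν * (1# - t)) * (1# - F))
        ≈⟨ solve 3 (λ t ν F → t :* ((con (+ 1) :+ ν :* (con (+ 1) :- t)) :* (con (+ 1) :- F)) :=
             (t :+ (con (+ 1) :+ ν) :* (con (+ 1) :- t)) :* (t :* (con (+ 1) :- F))) refl t ν F ⟩
      (t + (1# + ν) * (1# - t)) * (t * (1# - F))
        ≈⟨ *-cong (+-congˡ (*-congʳ mean≈1+ν)) pgf≈ ⟨
      (t + mean * (1# - t)) * pgf pmf t ∎)
      where
      k : Fin K → ℕ
      k i = suc (suc (e i))
      x f : Fin K → ℝ
      x i = (k i · 1#) * (1# - t)
      f i = 1# - t ^ k i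
      F N : ℝ
      F = sum (λ i → w i * f i)
      N = sum (λ i → w i * x i)
      0≤ν : 0# ≤ ν
      0≤ν = sum-nonNegative {K} (λ i → *-nonNegative (0≤w i) (·-nonNegative (k i) 0≤1))
      1≤mean : 1# ≤ mean
      1≤mean = ≤-from-slack 0≤ν mean≈1+ν
      N≈νδ : N ≈ ν * (1# - t)
      N≈νδ = trans (sum-cong-≋ {K} (λ i → sym (*-assoc _ _ _))) (sym (*-distribʳ-sum {K} (1# - t) _))
      0≤x : ∀ i → 0# ≤ x i
      0≤x i = *-nonNegative (·-nonNegative (k i) 0≤1) (0≤-diff t≤1)
      0≤xf : ∀ i → 0# ≤ x i * f i
      0≤xf i = *-nonNegative (0≤x i) (0≤-diff (^-≤1 0≤t t≤1 (k i)))
      f-mono : ∀ {i j} → k i ℕ.≤ k j → f i ≤ f j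
      f-mono {i} {j} ki≤kj = ≤-from-slack (0≤-diff (^-antitone 0≤t t≤1 ki≤kj))
        (solve 2 (λ y z → con (+ 1) :- z := con (+ 1) :- y :+ (y :- z)) refl (t ^ k i) (t ^ k j))
      ·-mono : ∀ {m n} → m ℕ.≤ n → m · 1# ≤ n · 1#
      ·-mono {n = n} ℕ.z≤n = ·-nonNegative n 0≤1
      ·-mono (ℕ.s≤s m≤n)   = +-monoʳ-≤ 1# (·-mono m≤n)
      -- Both `x` and `f` increase with `k`, so the mixed product is at most the diagonal product of
      -- whichever index has the larger `k`.
      cross : ∀ i j → x i * f j ≤ x i * f i + x j * f j
      cross i j with ℕ.≤-total (k i) (k j)
      ... | inj₁ ki≤kj = begin
        x i * f j                    ≤⟨ *-monoʳ-≤ (0≤-diff (^-≤1 0≤t t≤1 (k j))) (*-monoʳ-≤ (0≤-diff t≤1) (·-mono ki≤kj)) ⟩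
        x j * f j                    ≤⟨ ≤-from-slack (0≤xf i) (+-comm _ _) ⟩
        x i * f i + x j * f j        ∎
      ... | inj₂ kj≤ki = begin
        x i * f j                    ≤⟨ *-monoˡ-≤ (0≤x i) (f-mono {j} {i} kj≤ki) ⟩
        x i * f i                    ≤⟨ ≤-from-slack (0≤xf j) refl ⟩
        x i * f i + x j * f j        ∎
      F[1+N]≤N : F * (1# + N) ≤ N
      F[1+N]≤N = dilution w x f 0≤w 0≤xf 8W≤1 (λ i → bernoulli₄ 0≤t t≤1 (e i)) cross
      pgf≈ : pgf pmf t ≈ t * (1# - F)
      pgf≈ = begin-equality
        pgf pmf t
          ≈⟨ 𝔼-law (^-nonNegative 0≤t) ⟩
        (1# - sum w) * (t * 1#) + sum (λ i → w i * (t * t ^ k i))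
          ≈⟨ +-congˡ (trans (sum-cong-≋ {K} (λ i → solve 3 (λ w t y →
               w :* (t :* y) := t :* w :- t :* (w :* (con (+ 1) :- y))) refl (w i) t (t ^ k i)))
               (trans (sum-sub {K} _ _) (sym (+-cong (*-distribˡ-sum {K} t w) (-‿cong (*-distribˡ-sum {K} t _)))))) ⟩
        (1# - sum w) * (t * 1#) + (t * sum w - t * F)
          ≈⟨ solve 3 (λ W t F → (con (+ 1) :- W) :* (t :* con (+ 1)) :+ (t :* W :- t :* F) :=
               t :* (con (+ 1) :- F)) refl (sum w) t F ⟩
        t * (1# - F) ∎

-- Cutoff level, geometric scales and level weights

-- The number `j` is the first index satisfying `P`, or `n` when there is none. The latter is a
-- threshold above all values; the last clause is then vacuous and every level counts as lying below
-- the cutoff.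
cutoff : ∀ {n} {P : Fin n → Set} → (∀ i → Dec (P i)) →
         ∃[ j ] (∀ i → toℕ i ℕ.< j → ¬ P i) ×
                (∀ (i : Fin n) → j ℕ.≤ toℕ i → ∃[ l ] toℕ l ≡ j × P l)
cutoff {zero}      P? = 0 , (λ ()) , (λ ())
cutoff {suc n} {P} P? with P? Fin.zero | cutoff {P = P ∘ Fin.suc} (P? ∘ Fin.suc)
... | yes p | _ = 0 , (λ _ ()) , λ _ _ → Fin.zero , ≡.refl , p
... | no ¬p | j , below , above = suc j , below⁺ , above⁺
  where
  below⁺ : ∀ (i : Fin (suc n)) → toℕ i ℕ.< suc j → ¬ P i
  below⁺ Fin.zero    _           = ¬p
  below⁺ (Fin.suc i) (ℕ.s≤s i<j) = below i i<j
  above⁺ : ∀ (i : Fin (suc n)) → suc j ℕ.≤ toℕ i → ∃[ l ] toℕ l ≡ suc j × P l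
  above⁺ (Fin.suc i) (ℕ.s≤s j≤i) with above i j≤i
  ... | l , l≡j , q = Fin.suc l , ≡.cong suc l≡j , q

module Scales (R : CompleteOrderedField) where

  open CompleteOrderedField R renaming (Carrier to ℝ)
  open ProphetInequality R
  open OrderedFieldProperties R
  open GeometricDomination R
  open Relation.Binary.Reasoning.PartialOrder poset

  -- 1/2, 1/16, 1/32 and 16
  a α ρ B : ℝ
  a = (2 ·′ 1#) ⁻¹
  α = a * a * a * a
  ρ = α * a
  B = 16 ·′ 1#

  2a≈1 : (2 ·′ 1#) * a ≈ 1#
  2a≈1 = ⁻¹-inverseʳ _ (1≤⇒≉0 1≤2)

  0≤a : 0# ≤ a
  0≤a = halve (begin
    (1# + 1#) * 0#    ≈⟨ zeroʳ _ ⟩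
    0#                ≤⟨ 0≤1 ⟩
    1#                ≈⟨ 2a≈1 ⟨
    (1# + 1#) * a     ∎)

  a+a≈1 : a + a ≈ 1#
  a+a≈1 = trans (solve 1 (λ a → a :+ a := con (+ 2) :* a) refl a) 2a≈1

  a≤1 : a ≤ 1#
  a≤1 = ≤-from-slack 0≤a (sym a+a≈1)

  *a-≤ : ∀ {x} → 0# ≤ x → x * a ≤ x
  *a-≤ 0≤x = ≤-trans (*-monoˡ-≤ 0≤x a≤1) (≤-reflexive (*-identityʳ _))

  0≤a³ : 0# ≤ a * a * a
  0≤a³ = *-nonNegative (*-nonNegative 0≤a 0≤a) 0≤a

  0≤α : 0# ≤ α
  0≤α = *-nonNegative 0≤a³ 0≤a

  0≤ρ : 0# ≤ ρ
  0≤ρ = *-nonNegative 0≤α 0≤a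

  0≤B : 0# ≤ B
  0≤B = ·′1-nonNegative 16

  a³≤a : a * a * a ≤ a
  a³≤a = ≤-trans (*a-≤ (*-nonNegative 0≤a 0≤a)) (*a-≤ 0≤a)

  α≤a : α ≤ a
  α≤a = ≤-trans (*a-≤ 0≤a³) a³≤a

  8a³≈1 : (8 ·′ 1#) * (a * a * a) ≈ 1#
  8a³≈1 = trans (solve 1 (λ a → con (+ 8) :* (a :* a :* a) :=
      con (+ 2) :* a :* (con (+ 2) :* a) :* (con (+ 2) :* a)) refl a)
    (trans (*-cong (*-cong 2a≈1 2a≈1) 2a≈1) (trans (*-congʳ (*-identityˡ 1#)) (*-identityˡ 1#)))

  αB≈1 : α * B ≈ 1#
  αB≈1 = trans (solve 1 (λ a → a :* a :* a :* a :* con (+ 16) :=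
      con (+ 8) :* (a :* a :* a) :* (con (+ 2) :* a)) refl a)
    (trans (*-cong 8a³≈1 2a≈1) (*-identityˡ 1#))

  Bρ≈a : B * ρ ≈ a
  Bρ≈a = trans (solve 2 (λ B a → B :* (a :* a :* a :* a :* a) := a :* a :* a :* a :* B :* a) refl B a)
    (trans (*-congʳ αB≈1) (*-identityˡ a))

  ρ2≈α : ρ * (2 ·′ 1#) ≈ α
  ρ2≈α = trans (solve 2 (λ α a → α :* a :* con (+ 2) := α :* (con (+ 2) :* a)) refl α a)
    (trans (*-congˡ 2a≈1) (*-identityʳ α))

  ρ32≈1 : ρ * (32 ·′ 1#) ≈ 1#
  ρ32≈1 = trans (solve 2 (λ α a → α :* a :* con (+ 32) := α :* con (+ 16) :* (con (+ 2) :* a)) refl α a)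
    (trans (*-cong αB≈1 2a≈1) (*-identityˡ 1#))

  α32≈2 : α * (32 ·′ 1#) ≈ 2 ·′ 1#
  α32≈2 = trans (solve 1 (λ α → α :* con (+ 32) := α :* con (+ 16) :* con (+ 2)) refl α)
    (trans (*-congʳ αB≈1) (*-identityˡ _))

  ^-combine : ∀ {x y z} → x * y ≈ z → ∀ n → x ^ n * y ^ n ≈ z ^ n
  ^-combine {x} {y} xy≈z n = trans (sym (^-distrib-* x y n)) (^-congˡ n xy≈z)

  ^-inverse : ∀ {x y} → x * y ≈ 1# → ∀ n → x ^ n * y ^ n ≈ 1#
  ^-inverse xy≈1 n = trans (^-combine xy≈1 n) (1^n≈1 n)

  ℕ-^ : ∀ m n → (m ℕ.^ n) · 1# ≈ (m · 1#) ^ n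
  ℕ-^ m zero    = +-identityʳ 1#
  ℕ-^ m (suc n) = trans (·1-homo-* m (m ℕ.^ n)) (*-congˡ (ℕ-^ m n))

  cast32 : ∀ n → (32 ℕ.^ n) · 1# ≈ (32 ·′ 1#) ^ n
  cast32 n = trans (ℕ-^ 32 n) (^-congˡ n (×ᵤ≈× 32 1#))

  sum-powers-≤2 : ∀ n → partialSum (a ^_) n ≤ 1# + 1#
  sum-powers-≤2 n = begin
    partialSum (a ^_) n
      ≈⟨ trans (sym (*-identityˡ _)) (*-congʳ (sym 2a≈1)) ⟩
    (1# + 1#) * a * partialSum (a ^_) n
      ≈⟨ *-assoc _ _ _ ⟩
    (1# + 1#) * (a * partialSum (a ^_) n)
      ≈⟨ *-congˡ (*-congʳ (trans (solve 1 (λ a → a := a :+ a :- a) refl a) (+-congʳ a+a≈1))) ⟩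
    (1# + 1#) * ((1# - a) * partialSum (a ^_) n)
      ≤⟨ *-monoˡ-≤ 0≤2
           (geometric-partialSum a (a ^_) (^-nonNegative 0≤a) (λ _ → refl) n) ⟩
    (1# + 1#) * 1#
      ≈⟨ *-identityʳ _ ⟩
    1# + 1# ∎

  -- The extra `a ^ j` is the sum over all negative i of the two-sided series, whose total is 3. It
  -- closes the induction: when `n` and `j` both drop by one, the head term and the extra term merge
  -- into the new extra term.
  sum-∣-∣-≤3 : ∀ n j → partialSum (λ i → a ^ ∣ i - j ∣) n + a ^ j ≤ 3 ·′ 1#
  sum-∣-∣-≤3 zero j = begin
    0# + a ^ j    ≈⟨ +-identityˡ _ ⟩
    a ^ j         ≤⟨ ^-≤1 0≤a a≤1 j ⟩
    1#            ≤⟨ ≤-from-slack 0≤2 (solve 0 (con (+ 3) := con (+ 1) :+ con (+ 2)) refl) ⟩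
    3 ·′ 1#       ∎
  sum-∣-∣-≤3 (suc n) zero = begin
    partialSum (λ i → a ^ ∣ i - 0 ∣) (suc n) + 1#
      ≈⟨ +-congʳ (sum-cong-≋ {suc n} (λ i → reflexive (≡.cong (a ^_) (ℕ.∣-∣-identityʳ (toℕ i))))) ⟩
    partialSum (a ^_) (suc n) + 1#
      ≤⟨ +-mono-≤ (sum-powers-≤2 (suc n)) ≤-refl ⟩
    3 ·′ 1# ∎
  sum-∣-∣-≤3 (suc n) (suc j) = begin
    (a * a ^ j + T) + a * a ^ j
      ≈⟨ solve 3 (λ a y T → a :* y :+ T :+ a :* y := T :+ (a :+ a) :* y) refl a (a ^ j) T ⟩
    T + (a + a) * a ^ j
      ≈⟨ +-congˡ (trans (*-congʳ a+a≈1) (*-identityˡ _)) ⟩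
    T + a ^ j
      ≤⟨ sum-∣-∣-≤3 n j ⟩
    3 ·′ 1# ∎
    where T = partialSum (λ i → a ^ ∣ i - j ∣) n

  0≤a^ : ∀ n → 0# ≤ a ^ n
  0≤a^ = ^-nonNegative 0≤a

  sum-∣-∣ : ∀ n j → sum {n} (λ i → a ^ ∣ toℕ i - j ∣) ≤ 3 ·′ 1#
  sum-∣-∣ n j = ≤-trans (≤-from-slack (0≤a^ j) refl) (sum-∣-∣-≤3 n j)

  -- Bernoulli's inequality in reciprocal form. For hp ≥ 1/2 it gives (1-p)^h ≤ 2/3, so an outcome
  -- of probability p occurs within h draws with probability at least 1/3.
  bernoulli⁻¹ : ∀ {p} → 0# ≤ p → p ≤ 1# → ∀ h → (1# - p) ^ h * (1# + (h · 1#) * p) ≤ 1#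
  bernoulli⁻¹ {p} 0≤p p≤1 zero = ≤-reflexive
    (solve 1 (λ p → con (+ 1) :* (con (+ 1) :+ con (+ 0) :* p) := con (+ 1)) refl p)
  bernoulli⁻¹ {p} 0≤p p≤1 (suc h) = ≤-from-slack
    (+-nonNegative (0≤-diff (bernoulli⁻¹ 0≤p p≤1 h))
      (*-nonNegative (^-nonNegative (0≤-diff p≤1) h)
        (*-nonNegative (·-nonNegative (suc h) 0≤1) (*-nonNegative 0≤p 0≤p))))
    (solve 3 (λ p y c → con (+ 1) := (con (+ 1) :- p) :* y :* (con (+ 1) :+ (con (+ 1) :+ c) :* p) :+
      (con (+ 1) :- y :* (con (+ 1) :+ c :* p) :+ y :* ((con (+ 1) :+ c) :* (p :* p))))
      refl p ((1# - p) ^ h) (h · 1#))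

  -- The ratio is written as b/2 because z / (1 - z) ≤ 2z for z ≤ 1/2, so that `b` itself bounds the
  -- mass outside level 0.
  module Weights (b : ℝ) (0≤b : 0# ≤ b) (b≤a : b ≤ a) (K : ℕ) where

    z : ℝ
    z = b * a

    0≤z : 0# ≤ z
    0≤z = *-nonNegative 0≤b 0≤a

    w : Fin K → ℝ
    w i = z ^ suc (toℕ i)

    0≤w : ∀ i → 0# ≤ w i
    0≤w i = ^-nonNegative 0≤z (suc (toℕ i))

    ∑w≤b : sum w ≤ b
    ∑w≤b = halve′ (begin
      a * sum w           ≤⟨ *-monoʳ-≤ (sum-nonNegative {K} 0≤w) a≤1-z ⟩
      (1# - z) * sum w    ≤⟨ geometric-partialSum z (λ k → z ^ suc k) (λ k → ^-nonNegative 0≤z (suc k)) (λ _ → refl) K ⟩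
      z * 1#              ≈⟨ trans (*-identityʳ z) (*-comm b a) ⟩
      a * b               ∎)
      where
      a≤1-z : a ≤ 1# - z
      a≤1-z = ≤-from-slack (0≤-diff (≤-trans (*a-≤ 0≤b) b≤a))
        (trans (+-congʳ (sym a+a≈1)) (solve 2 (λ a z → a :+ a :- z := a :+ (a :- z)) refl a z))
      halve′ : ∀ {x y} → a * x ≤ a * y → x ≤ y
      halve′ = *-cancelˡ-≤ 0≤a λ a≈0 → 0≉1 (trans (sym (trans (+-cong a≈0 a≈0) (+-identityˡ 0#))) a+a≈1)

    ∑w≤1 : sum w ≤ 1#
    ∑w≤1 = ≤-trans ∑w≤b (≤-trans b≤a a≤1)

    complete-≤ : ∀ i → complete w i ≤ z ^ toℕ i
    complete-≤ Fin.zero    = 1-≤1 (sum-nonNegative {K} 0≤w)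
    complete-≤ (Fin.suc i) = ≤-refl

    ≤-2complete : ∀ i → z ^ toℕ i ≤ (2 ·′ 1#) * complete w i
    -- The leftover mass is at least 1/2, since the other weights sum to at most b ≤ 1/2.
    ≤-2complete Fin.zero    = ≤-from-slack
      (*-nonNegative 0≤2 (0≤-diff (≤-trans ∑w≤b b≤a)))
      (trans (solve 2 (λ W a → con (+ 2) :* (con (+ 1) :- W) :=
          (con (+ 2) :- con (+ 2) :* a) :+ con (+ 2) :* (a :- W)) refl (sum w) a)
        (+-congʳ (trans (+-congˡ (-‿cong 2a≈1)) (solve 0 (con (+ 2) :- con (+ 1) := con (+ 1)) refl))))
    ≤-2complete (Fin.suc i) = ≤-from-slack (0≤w i)
      (solve 1 (λ y → con (+ 2) :* y := y :+ y) refl (w i))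

-- The hard instance with K + 1 levels

module HardInstance (em : ExcludedMiddle 0ℓ) (R : CompleteOrderedField) (K : ℕ) where

  open CompleteOrderedField R renaming (Carrier to ℝ)
  open ProphetInequality R
  open OrderedFieldProperties R
  open Scales R
  open Indicators em R
  open Relation.Binary.Reasoning.PartialOrder poset

  module Wʰ = Weights (a * a * a) 0≤a³ a³≤a K
  module Wᵛ = Weights α 0≤α α≤a K

  n : ℕ
  n = suc K

  p : Fin n → ℝ
  p = complete Wᵛ.w

  X : Fin n → ℝ
  X i = B ^ toℕ i

  0≤X : ∀ i → 0# ≤ X i
  0≤X i = ^-nonNegative 0≤B (toℕ i)

  0≤p : ∀ i → 0# ≤ p i
  0≤p = complete-nonNegative Wᵛ.0≤w Wᵛ.∑w≤1

  open FiniteValues em R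
  open FiniteValue p 0≤p (complete-total Wᵛ.w) X 0≤X

  8∑w≤1 : (8 ·′ 1#) * sum Wʰ.w ≤ 1#
  8∑w≤1 = ≤-trans (*-monoˡ-≤ (·′1-nonNegative 8) Wʰ.∑w≤b) (≤-reflexive 8a³≈1)

  open MostlyOneHorizons em R
  open MostlyOne Wʰ.w Wʰ.0≤w 8∑w≤1 (λ i → 32 ℕ.^ suc (toℕ i) ℕ.∸ 3) public
    using (H; H∈Ḡ; w⁺; 0≤w⁺; η; 𝔼-law)

  D : Value
  D = value

  -- Subtracting 3 in the horizon levels undoes the offset of `MostlyOne`, without truncation
  -- because the powers from level 1 on are at least 32. Level 0 fits the same formula.
  η≡ : ∀ i → η i ≡ 32 ℕ.^ toℕ i
  η≡ Fin.zero    = ≡.refl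
  η≡ (Fin.suc i) = ℕ.m+[n∸m]≡n (ℕ.≤-trans (ℕ.m≤m+n 3 29)
    (ℕ.m≤m*n 32 (32 ℕ.^ toℕ i) {{ℕ.m^n≢0 32 (toℕ i)}}))

  cast-η : ∀ i → η i · 1# ≈ (32 ·′ 1#) ^ toℕ i
  cast-η i = trans (reflexive (≡.cong (_· 1#) (η≡ i))) (cast32 (toℕ i))

  𝔼-M : 𝔼[ H , D ] M ≈ sum (λ i → w⁺ i * maxReward (η i))
  -- The nonnegativity of `maxReward` is read off from its lower bound at level 0.
  𝔼-M = 𝔼-law {maxReward} (λ h → ≤-trans
    (*-nonNegative (0≤X Fin.zero) (0≤-diff (^-≤1 (0≤-diff p≤1) (1-≤1 (0≤p Fin.zero)) h)))
    (maxReward-lower Fin.zero h))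
    where
    p≤1 : p Fin.zero ≤ 1#
    p≤1 = 1-≤1 (sum-nonNegative {K} Wᵛ.0≤w)

  -- The constant is 2 times 3: the weight times the value is at least 1/2, and by `bernoulli⁻¹` the
  -- value is seen within the horizon with probability at least 1/3.
  level-M : ∀ i → 1# ≤ (6 ·′ 1#) * (w⁺ i * maxReward (η i))
  level-M i = begin
    1#
      ≈⟨ *-identityˡ 1# ⟨
    1# * 1#
      ≤⟨ *-mono-≤ 0≤1 (≤-trans 0≤1 1≤2wX) 1≤2wX 1≤3[1-y] ⟩
    (2 ·′ 1#) * w⁺ i * X i * ((3 ·′ 1#) * (1# - y))
      ≈⟨ solve 3 (λ w x y → con (+ 2) :* w :* x :* (con (+ 3) :* (con (+ 1) :- y)) :=
           con (+ 6) :* (w :* (x :* (con (+ 1) :- y)))) refl (w⁺ i) (X i) y ⟩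
    (6 ·′ 1#) * (w⁺ i * (X i * (1# - y)))
      ≤⟨ *-monoˡ-≤ (·′1-nonNegative 6) (*-monoˡ-≤ (0≤w⁺ i) (maxReward-lower i (η i))) ⟩
    (6 ·′ 1#) * (w⁺ i * maxReward (η i)) ∎
    where
    y = (1# - p i) ^ η i
    p≤1 : p i ≤ 1#
    p≤1 = ≤-trans (Wᵛ.complete-≤ i)
      (^-≤1 0≤ρ (≤-trans (*a-≤ 0≤α) (≤-trans α≤a a≤1)) (toℕ i))
    0≤y : 0# ≤ y
    0≤y = ^-nonNegative (0≤-diff p≤1) (η i)
    1≤2wX : 1# ≤ (2 ·′ 1#) * w⁺ i * X i
    1≤2wX = begin
      1#                          ≈⟨ ^-inverse αB≈1 (toℕ i) ⟨
      α ^ toℕ i * B ^ toℕ i       ≤⟨ *-monoʳ-≤ (0≤X i) (Wʰ.≤-2complete i) ⟩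
      (2 ·′ 1#) * w⁺ i * X i      ∎
    1≤2hp : 1# ≤ (2 ·′ 1#) * ((η i · 1#) * p i)
    1≤2hp = begin
      1#                                    ≈⟨ ^-inverse ρ32≈1 (toℕ i) ⟨
      ρ ^ toℕ i * (32 ·′ 1#) ^ toℕ i        ≈⟨ *-congˡ (cast-η i) ⟨
      ρ ^ toℕ i * (η i · 1#)                ≤⟨ *-monoʳ-≤ (·-nonNegative (η i) 0≤1) (Wᵛ.≤-2complete i) ⟩
      (2 ·′ 1#) * p i * (η i · 1#)          ≈⟨ trans (*-assoc _ _ _) (*-congˡ (*-comm _ _)) ⟩
      (2 ·′ 1#) * ((η i · 1#) * p i)        ∎
    1≤3[1-y] : 1# ≤ (3 ·′ 1#) * (1# - y)
    1≤3[1-y] = ≤-from-slack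
      (+-nonNegative (*-nonNegative 0≤2 (0≤-diff (bernoulli⁻¹ (0≤p i) p≤1 (η i))))
        (*-nonNegative 0≤y (0≤-diff 1≤2hp)))
      (solve 2 (λ y z → con (+ 3) :* (con (+ 1) :- y) := con (+ 1) :+
        (con (+ 2) :* (con (+ 1) :- y :* (con (+ 1) :+ z)) :+ y :* (con (+ 2) :* z :- con (+ 1))))
        refl y ((η i · 1#) * p i))

  module SelectedLevels
    (π : ℝ) (j : ℕ) (rejected : ∀ i → toℕ i ℕ.< j → ¬ (π ≤ X i))
    (accepted : ∀ (i : Fin n) → j ℕ.≤ toℕ i → ∃[ l ] toℕ l ≡ j × π ≤ X l) where

    open Threshold π

    -- Level i contributes at most 32^-i 16^i = 2^-i from the cutoff on and nothing below it.
    -- Splitting 2^-i as 2^-j 2^-(i-j) lets the two-sided bound `sum-∣-∣` supply the constant.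
    truncated-mean : s ≤ (3 ·′ 1#) * a ^ j
    truncated-mean = begin
      s                                                 ≤⟨ sum-mono {n} term ⟩
      sum {n} (λ i → a ^ j * a ^ ∣ toℕ i - j ∣)         ≈⟨ *-distribˡ-sum {n} (a ^ j) (λ i → a ^ ∣ toℕ i - j ∣) ⟨
      a ^ j * sum {n} (λ i → a ^ ∣ toℕ i - j ∣)         ≤⟨ *-monoˡ-≤ (0≤a^ j) (sum-∣-∣ n j) ⟩
      a ^ j * (3 ·′ 1#)                                 ≈⟨ *-comm _ _ ⟩
      (3 ·′ 1#) * a ^ j                                 ∎
      where
      term : ∀ i → p i * (u i * X i) ≤ a ^ j * a ^ ∣ toℕ i - j ∣
      term i with toℕ i ℕ.<? j
      ... | yes i<j = ≤-respˡ-≈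
        (sym (trans (*-congˡ (trans (*-congʳ (𝟙-false (rejected i i<j))) (zeroˡ _))) (zeroʳ _)))
        (*-nonNegative (0≤a^ j) (0≤a^ ∣ toℕ i - j ∣))
      ... | no  i≮j with ℕ.m≤n⇒∃[o]m+o≡n (ℕ.≮⇒≥ i≮j)
      ...   | d , j+d≡i = begin
        p i * (u i * X i)
          ≤⟨ *-monoˡ-≤ (0≤p i) (≤-trans (*-monoʳ-≤ (0≤X i) (𝟙-≤1 _)) (≤-reflexive (*-identityˡ _))) ⟩
        p i * X i
          ≤⟨ *-monoʳ-≤ (0≤X i) (Wᵛ.complete-≤ i) ⟩
        ρ ^ toℕ i * B ^ toℕ i
          ≈⟨ ^-combine (trans (*-comm ρ B) Bρ≈a) (toℕ i) ⟩
        a ^ toℕ i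
          ≡⟨ ≡.cong (a ^_) j+d≡i ⟨
        a ^ (j ℕ.+ d)
          ≈⟨ ^-homo-* a j d ⟩
        a ^ j * a ^ d
          ≡⟨ ≡.cong (λ k → a ^ j * a ^ k) (≡.trans (≡.cong ∣_- j ∣ (≡.sym j+d≡i))
               (≡.trans (ℕ.∣-∣-comm (j ℕ.+ d) j) (ℕ.∣m-m+n∣≡n j d))) ⟨
        a ^ j * a ^ ∣ toℕ i - j ∣ ∎

    -- Weight times horizon is at most 16^-i 32^i = 2^i, which against the truncated mean leaves 3
    -- times 2^-(j-i). The 3 is relaxed to 6 to share one bound with the levels above.
    level-Y-below : ∀ i d → toℕ i ℕ.+ d ≡ j →
                    w⁺ i * reward (η i) ≤ (6 ·′ 1#) * a ^ ∣ toℕ i - j ∣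
    level-Y-below i d i+d≡j = begin
      w⁺ i * reward (η i)
        ≤⟨ *-mono-≤ (reward-nonNegative (η i)) (^-nonNegative 0≤α I) (Wʰ.complete-≤ i)
             (≤-trans (reward-≤-* (η i)) (≤-trans
               (≤-reflexive (*-congʳ (cast-η i)))
               (*-monoˡ-≤ (^-nonNegative (·′1-nonNegative 32) I) truncated-mean))) ⟩
      α ^ I * ((32 ·′ 1#) ^ I * ((3 ·′ 1#) * a ^ j))
        ≈⟨ trans (sym (*-assoc _ _ _)) (*-congʳ (^-combine α32≈2 I)) ⟩
      (2 ·′ 1#) ^ I * ((3 ·′ 1#) * a ^ j)
        ≈⟨ *-congˡ (*-congˡ (trans (reflexive (≡.cong (a ^_) (≡.sym i+d≡j))) (^-homo-* a I d))) ⟩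
      (2 ·′ 1#) ^ I * ((3 ·′ 1#) * (a ^ I * a ^ d))
        ≈⟨ solve 3 (λ x y z → x :* (con (+ 3) :* (y :* z)) := x :* y :* (con (+ 3) :* z)) refl ((2 ·′ 1#) ^ I) (a ^ I) (a ^ d) ⟩
      (2 ·′ 1#) ^ I * a ^ I * ((3 ·′ 1#) * a ^ d)
        ≈⟨ trans (*-congʳ (^-inverse 2a≈1 I)) (*-identityˡ _) ⟩
      (3 ·′ 1#) * a ^ d
        ≤⟨ ≤-from-slack (*-nonNegative (·′1-nonNegative 3) (0≤a^ d))
             (solve 1 (λ y → con (+ 6) :* y := con (+ 3) :* y :+ con (+ 3) :* y) refl (a ^ d)) ⟩
      (6 ·′ 1#) * a ^ d
        ≡⟨ ≡.cong (λ k → (6 ·′ 1#) * a ^ k)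
             (≡.trans (≡.cong (∣ I -_∣) (≡.sym i+d≡j)) (ℕ.∣m-m+n∣≡n I d)) ⟨
      (6 ·′ 1#) * a ^ ∣ I - j ∣ ∎
      where I = toℕ i

    -- Acceptance of level j alone gives ℙ(X ≥ π) ≥ 32^-j / 2, so the reward is at most 6 times 16^j
    -- at any horizon. The weight 16^-i turns this into 6 times 16^-(i-j), which is relaxed to
    -- powers of 1/2.
    level-Y-above : ∀ i d → j ℕ.+ d ≡ toℕ i → ∀ l → toℕ l ≡ j → π ≤ X l →
                    w⁺ i * reward (η i) ≤ (6 ·′ 1#) * a ^ ∣ toℕ i - j ∣
    level-Y-above i d j+d≡i l l≡j π≤Xl = begin
      w⁺ i * r
        ≤⟨ *-monoʳ-≤ 0≤r (Wʰ.complete-≤ i) ⟩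
      α ^ toℕ i * r
        ≈⟨ *-congʳ (trans (reflexive (≡.cong (α ^_) (≡.sym j+d≡i))) (^-homo-* α j d)) ⟩
      α ^ j * α ^ d * r
        ≈⟨ *-congʳ (*-congʳ (^-combine ρ2≈α j)) ⟨
      ρ ^ j * (2 ·′ 1#) ^ j * α ^ d * r
        ≈⟨ solve 4 (λ x y z r → x :* y :* z :* r := y :* z :* (x :* r))
             refl (ρ ^ j) ((2 ·′ 1#) ^ j) (α ^ d) r ⟩
      (2 ·′ 1#) ^ j * α ^ d * (ρ ^ j * r)
        ≤⟨ *-monoˡ-≤ (*-nonNegative 0≤2^j (^-nonNegative 0≤α d)) ρʲr≤ ⟩
      (2 ·′ 1#) ^ j * α ^ d * ((6 ·′ 1#) * a ^ j)
        ≈⟨ solve 3 (λ x y z → x :* z :* (con (+ 6) :* y) := x :* y :* (con (+ 6) :* z))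
             refl ((2 ·′ 1#) ^ j) (a ^ j) (α ^ d) ⟩
      (2 ·′ 1#) ^ j * a ^ j * ((6 ·′ 1#) * α ^ d)
        ≈⟨ trans (*-congʳ (^-inverse 2a≈1 j)) (*-identityˡ _) ⟩
      (6 ·′ 1#) * α ^ d
        ≤⟨ *-monoˡ-≤ (·′1-nonNegative 6) (^-mono-≤ 0≤α α≤a d) ⟩
      (6 ·′ 1#) * a ^ d
        ≡⟨ ≡.cong (λ k → (6 ·′ 1#) * a ^ k) (≡.trans (≡.cong ∣_- j ∣ (≡.sym j+d≡i))
             (≡.trans (ℕ.∣-∣-comm (j ℕ.+ d) j) (ℕ.∣m-m+n∣≡n j d))) ⟨
      (6 ·′ 1#) * a ^ ∣ toℕ i - j ∣ ∎
      where
      r = reward (η i)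
      0≤r = reward-nonNegative (η i)
      0≤2^j : 0# ≤ (2 ·′ 1#) ^ j
      0≤2^j = ^-nonNegative (·′1-nonNegative 2) j
      ρʲr≤ : ρ ^ j * r ≤ (6 ·′ 1#) * a ^ j
      ρʲr≤ = begin
        ρ ^ j * r                             ≡⟨ ≡.cong (λ k → ρ ^ k * r) l≡j ⟨
        ρ ^ toℕ l * r                         ≤⟨ *-monoʳ-≤ 0≤r (Wᵛ.≤-2complete l) ⟩
        (2 ·′ 1#) * p l * r                   ≈⟨ *-assoc _ _ _ ⟩
        (2 ·′ 1#) * (p l * r)                 ≤⟨ *-monoˡ-≤ (·′1-nonNegative 2)
                                                   (≤-trans (p*reward-≤ l π≤Xl (η i)) truncated-mean) ⟩
        (2 ·′ 1#) * ((3 ·′ 1#) * a ^ j)       ≈⟨ solve 1 (λ y → con (+ 2) :* (con (+ 3) :* y) := con (+ 6) :* y) refl (a ^ j) ⟩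
        (6 ·′ 1#) * a ^ j                     ∎

    level-Y : ∀ i → w⁺ i * reward (η i) ≤ (6 ·′ 1#) * a ^ ∣ toℕ i - j ∣
    level-Y i = go (ℕ.<-≤-connex (toℕ i) j)
      where
      go : toℕ i ℕ.< j ⊎ j ℕ.≤ toℕ i → w⁺ i * reward (η i) ≤ (6 ·′ 1#) * a ^ ∣ toℕ i - j ∣
      go (inj₁ i<j) = let d , i+d≡j = ℕ.m≤n⇒∃[o]m+o≡n (ℕ.<⇒≤ i<j) in
        level-Y-below i d i+d≡j
      go (inj₂ j≤i) = let d , j+d≡i = ℕ.m≤n⇒∃[o]m+o≡n j≤i
                          l , l≡j , π≤Xl = accepted i j≤i in
        level-Y-above i d j+d≡i l l≡j π≤Xl

    ∑-level-Y : sum (λ i → w⁺ i * reward (η i)) ≤ 18 ·′ 1#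
    ∑-level-Y = begin
      sum (λ i → w⁺ i * reward (η i))                       ≤⟨ sum-mono {n} level-Y ⟩
      sum {n} (λ i → (6 ·′ 1#) * a ^ ∣ toℕ i - j ∣)         ≈⟨ *-distribˡ-sum {n} (6 ·′ 1#) (λ i → a ^ ∣ toℕ i - j ∣) ⟨
      (6 ·′ 1#) * sum {n} (λ i → a ^ ∣ toℕ i - j ∣)         ≤⟨ *-monoˡ-≤ (·′1-nonNegative 6) (sum-∣-∣ n j) ⟩
      (6 ·′ 1#) * (3 ·′ 1#)                                 ≈⟨ solve 0 (con (+ 6) :* con (+ 3) := con (+ 18)) refl ⟩
      18 ·′ 1#                                              ∎

  𝔼-Y-≤18 : ∀ π → 𝔼[ H , D ] (Y-τ π) ≤ 18 ·′ 1#
  𝔼-Y-≤18 π = ≤-trans (≤-reflexive (𝔼-law (Threshold.reward-nonNegative π)))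
    (let j , rejected , accepted = cutoff (λ i → π ≤? X i) in
     SelectedLevels.∑-level-Y π j rejected accepted)

  levels-≤-𝔼-M : ∀ {c} → 0# ≤ c → partialSum (λ _ → c) n ≤ (6 ·′ 1#) * (c * 𝔼[ H , D ] M)
  levels-≤-𝔼-M {c} 0≤c = begin
    sum {n} (λ _ → c)
      ≤⟨ sum-mono {n} (λ i → ≤-trans (≤-reflexive (sym (*-identityʳ c))) (*-monoˡ-≤ 0≤c (level-M i))) ⟩
    sum {n} (λ i → c * ((6 ·′ 1#) * (w⁺ i * maxReward (η i))))
      ≈⟨ trans (*-congˡ (*-distribˡ-sum {n} (6 ·′ 1#) level)) (*-distribˡ-sum {n} c (λ i → (6 ·′ 1#) * level i)) ⟨
    c * ((6 ·′ 1#) * sum (λ i → w⁺ i * maxReward (η i)))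
      ≈⟨ *-congˡ (*-congˡ 𝔼-M) ⟨
    c * ((6 ·′ 1#) * 𝔼[ H , D ] M)
      ≈⟨ solve 2 (λ c m → c :* (con (+ 6) :* m) := con (+ 6) :* (c :* m)) refl c _ ⟩
    (6 ·′ 1#) * (c * 𝔼[ H , D ] M) ∎
    where
    level : Fin n → ℝ
    level i = w⁺ i * maxReward (η i)

-- The Archimedean property and the conclusion

module Archimedean (R : CompleteOrderedField) where

  open CompleteOrderedField R renaming (Carrier to ℝ)
  open ProphetInequality R
  open OrderedFieldProperties R
  open Series R

  -- Adding c to a multiple of c gives another multiple, so if S is their supremum then S - c is an
  -- upper bound too, and minimality of S forces c ≤ 0.
  bounded-multiples⇒≤0 : ∀ {c b} → (∀ n → partialSum (λ _ → c) n ≤ b) → c ≤ 0#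
  bounded-multiples⇒≤0 {c} bounded = ≤-from-slack
    (0≤-diff (proj₂ lub (S - c) below))
    (solve 2 (λ S c → con (+ 0) := c :+ (S :- c :- S)) refl S c)
    where
    S : ℝ
    S = ∑∞ (λ _ → c)
    lub : IsLub _≤_ (PartialSums (λ _ → c)) S
    lub = ∑∞-isLub (λ _ → c) (λ x (lift (n , x≈)) → ≤-trans (≤-reflexive x≈) (bounded n))
    below : UpperBound _≤_ (PartialSums (λ _ → c)) (S - c)
    below x (lift (n , x≈)) = ≤-from-slack
      (0≤-diff (proj₁ lub _ (lift (suc n , +-congˡ x≈))))
      (solve 3 (λ S c x → S :- c := x :+ (S :- (c :+ x))) refl S c x)

theorem3 : (∀ {ℓ} → ExcludedMiddle ℓ) →
           (R : CompleteOrderedField) →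
           let open CompleteOrderedField R
               open ProphetInequality R
           in
           ¬ (∃[ c ] 0# < c ×
                (∀ (H : Horizon) → H ∈ Ḡ → ∀ (D : Value) →
                   ∃[ π ] c * 𝔼[ H , D ] M ≤ 𝔼[ H , D ] (Y-τ π)))
theorem3 em R (c , (0≤c , 0≉c) , approx) = 0≉c (≤-antisym 0≤c (bounded-multiples⇒≤0 bounded))
  where
  open CompleteOrderedField R
  open ProphetInequality R
  open OrderedFieldProperties R
  open Archimedean R
  -- The instance with n levels gives n c ≤ 6 c 𝔼M ≤ 6 times 18, with the same `c` for every n.
  bounded : ∀ n → partialSum (λ _ → c) n ≤ (6 ·′ 1#) * (18 ·′ 1#)
  bounded zero    = *-nonNegative (·′1-nonNegative 6) (·′1-nonNegative 18)
  bounded (suc K) =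
    let π , cM≤Y = approx H H∈Ḡ D in
    ≤-trans (levels-≤-𝔼-M 0≤c)
      (*-monoˡ-≤ (·′1-nonNegative 6) (≤-trans cM≤Y (𝔼-Y-≤18 π)))
    where open HardInstance em R K
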